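{- For each nonnegative integer $k$, the sequence $(A_{k+1}(\ell))_{\ell=1}^{2k+1}$ is symmetric; that is, $A_{k+1}(\ell)=A_{k+1}(2k+2-\ell)$ for all $\ell\in\{1,\ldots,2k+1\}$.
   Context: $S_n$ is the set of permutations of $\{1,\ldots,n\}$, written as words $\pi=\pi_1\cdots\pi_n$. The (West) stack-sorting map $s:S_n\to S_n$ is defined by the following procedure on an input $\pi=\pi_1\cdots\pi_n$, using an initially empty vertical stack. At any point in time, if there is a next entry of the input and either it is smaller than the entry at the top of the stack or the stack is empty, then that next entry is placed on top of the stack. Otherwise, the entry at the top of the stack is removed and appended to the end of the output. The procedure terminates when the output has length $n$, and $s(\pi)$ is this output. A permutation $\pi\in S_n$ is uniquely sorted if $|s^{ -1}(\pi)|=1$. $A_{k+1}(\ell)$ denotes the number of uniquely sorted permutations $\pi\in S_{2k+1}$ with first entry $\pi_1=\ell$. -}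

module Defs where

open import Data.Bool.Base using (if_then_else_)
open import Data.List.Base
  using (List; []; _∷_; length; filter; head; applyUpTo; cartesianProductWith)
open import Data.List.Properties using (≡-dec)
open import Data.List.Relation.Unary.Unique.DecPropositional using (unique?)
open import Data.Maybe.Base using (just)
import Data.Maybe.Properties as Maybe
open import Data.Nat.Base using (ℕ; zero; suc; _+_; _*_; _<ᵇ_)
open import Data.Nat.Properties using (_≟_)
open import Relation.Binary.PropositionalEquality using (_≡_)
open import Relation.Nullary.Decidable using (_×-dec_)
open import Relation.Unary using (Decidable)

Word : Set
Word = List ℕ

words : List ℕ → ℕ → List Word
words letters zero    = [] ∷ []
words letters (suc n) = cartesianProductWith _∷_ letters (words letters n)

-- Sₙ as a duplicate-free list: a word of length n over {1, …, n} is a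
-- permutation exactly when its entries are pairwise distinct.
S : ℕ → List Word
S n = filter (unique? _≟_) (words (applyUpTo suc n) n)

-- stackSort stack input is the output still to be produced; the head of
-- stack is its top entry.
stackSort : List ℕ → Word → Word
stackSort []          []       = []
stackSort (t ∷ stack) []       = t ∷ stackSort stack []
stackSort []          (x ∷ xs) = stackSort (x ∷ []) xs
stackSort (t ∷ stack) (x ∷ xs) =
  if x <ᵇ t
  then stackSort (x ∷ t ∷ stack) xs
  else t ∷ stackSort stack (x ∷ xs)

s : Word → Word
s = stackSort []

preimages : ℕ → Word → List Word
preimages n π = filter (λ σ → ≡-dec _≟_ (s σ) π) (S n)

UniquelySorted : ℕ → Word → Set
UniquelySorted n π = length (preimages n π) ≡ 1

uniquelySorted? : ∀ n → Decidable (UniquelySorted n)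
uniquelySorted? n π = length (preimages n π) ≟ 1

StartsWith : ℕ → Word → Set
StartsWith ℓ π = head π ≡ just ℓ

startsWith? : ∀ ℓ → Decidable (StartsWith ℓ)
startsWith? ℓ π = Maybe.≡-dec _≟_ (head π) (just ℓ)

-- The index is shifted by one: A k ℓ is the number usually written
-- A_{k+1}(ℓ), which counts permutations of length 2k + 1.
A : ℕ → ℕ → ℕ
A k ℓ = length (filter (λ π → uniquelySorted? n π ×-dec startsWith? ℓ π) (S n))
  where
  n : ℕ
  n = 2 * k + 1

{-# OPTIONS --safe #-}
module Submission where

-- A decreasing binary tree with inorder word σ has postorder word s(σ). A sorted
-- word of length N has at most (N - 1) / 2 descents, and it is uniquely sorted
-- exactly when equality holds, that is, when its tree is "good": every node has
-- 0 or 2 children, and the left child exceeds the leftmost leaf of the right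
-- subtree. So A counts good trees by their leftmost leaf a.
--
-- Let P(a, t) be the exponential generating function of the good trees with
-- leftmost leaf a and labels in [0, t]. Counting all pairs of subtrees and
-- removing those whose left labels all lie below the leftmost leaf u on the right,
--   ∂P/∂t (a, t) = P(a, t) ∫₀ᵗ P(b, t) db - ∫ₐᵗ P(a, u) P(u, t) du,   P(a, a) = 1.
-- If ν′ = - ν * ν (convolution) and ν(0) = 1, then ν(a) ν(t - a) / ν(t) solves this
-- equation, and it is visibly invariant under a ↦ t - a.

open import Defs
open import Data.Bool.Base using (Bool; true; false; not; if_then_else_)
open import Data.Empty using (⊥; ⊥-elim)
import Data.Integer.Base as ℤ
open import Data.Integer.Base using (ℤ)
import Data.Integer.Properties as ℤ
open import Data.List.Base
  using (List; []; _∷_; _++_; [_]; length; map; mapMaybe; filter; head;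
         applyUpTo; applyDownFrom; cartesianProductWith)
open import Data.List.Membership.Propositional using (_∈_; _∉_)
open import Data.List.Membership.Propositional.Properties
open import Data.List.Properties
  using (length-map; length-mapMaybe; length-++; length-applyUpTo; length-applyDownFrom;
         map-++; map-∘; map-cong; map-id; ++-assoc; ++-identityʳ; ++-conicalʳ;
         ∷-injective; ∷ʳ-injective; ≡-dec; reverse-applyUpTo)
open import Data.List.Relation.Binary.Permutation.Propositional
  using (_↭_; refl; prep; swap; ↭-sym; ↭-trans; ↭-reflexive; ↭⇒↭ₛ)
  renaming (trans to ↭-chain)
open import Data.List.Relation.Binary.Permutation.Propositional.Properties
  using (∈-resp-↭; All-resp-↭; mapMaybe-↭; shift; drop-∷; drop-mid; ++-comm;
         ↭-length; ↭-reverse; ↭-empty-inv; ↭-singleton-inv)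
  renaming (map⁺ to ↭-map⁺; ++⁺ to ↭-++⁺; ++⁺ˡ to ↭-++⁺ˡ; ++⁺ʳ to ↭-++⁺ʳ)
open import Data.List.Relation.Binary.Permutation.Setoid.Properties
  using () renaming (Unique-resp-↭ to Unique-resp-↭ₛ)
open import Data.List.Relation.Binary.Sublist.Propositional
  using (_⊆_; []; _∷_; _∷ʳ_; lookup; ⊆-refl; ⊆-trans)
open import Data.List.Relation.Binary.Sublist.Propositional.Properties
  using (length-mono-≤; All-resp-⊆) renaming (++⁺ to ⊆-++⁺)
open import Data.List.Relation.Unary.All as All using (All; []; _∷_)
open import Data.List.Relation.Unary.All.Properties
  using () renaming (++⁻ˡ to All-++⁻ˡ; ++⁻ʳ to All-++⁻ʳ; ++⁺ to All-++⁺)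
open import Data.List.Relation.Unary.AllPairs as AllPairs using (AllPairs; []; _∷_)
import Data.List.Relation.Unary.AllPairs.Properties as AllPairs
open import Data.List.Relation.Unary.Any using (here; there)
open import Data.List.Relation.Unary.Unique.DecPropositional using (unique?)
open import Data.List.Relation.Unary.Unique.Propositional using (Unique)
import Data.List.Relation.Unary.Unique.Propositional.Properties as Unique
open import Data.Maybe.Base using (Maybe; just; nothing)
open import Data.Maybe.Properties using (just-injective)
open import Data.Nat.Base using (ℕ; zero; suc; _≤_; _<_; _>_; z≤n; s≤s)
open import Data.Nat.Properties
  using (_≟_; _<?_; <-cmp; ≤-refl; ≤-trans; ≤-reflexive; ≤-antisym; ≤-pred; ≤-<-trans; <-trans;
         <-irrefl; <⇒≤; <⇒≯; >⇒≢; n≤1+n; n<1+n; suc-injective; module ≤-Reasoning)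
open import Data.Product.Base using (∃; ∃₂; _×_; _,_; proj₁; proj₂)
open import Data.Sum.Base using (_⊎_; inj₁; inj₂)
open import Data.Unit.Base using (⊤; tt)
open import Function.Base using (_∘_; const; id)
open import Relation.Binary.Definitions using (tri<; tri≈; tri>)
open import Relation.Binary.PropositionalEquality
  using (_≡_; _≢_; _≗_; refl; sym; trans; cong; cong₂; subst; setoid; module ≡-Reasoning)
open import Relation.Nullary.Decidable using (does; yes; no; dec-true; dec-false; _×-dec_)

-- The condition on a node compares the largest label on the left with the leftmost leaf u on the
-- right, and P does not record largest labels. A violation, however, confines the left subtree to
-- [0, u], where P(a, u) counts it; hence the passage to the complement. In P(a, u) P(u, t) the
-- numerator ν(u) of the second factor cancels the denominator of the first. The subtracted integral
-- is therefore ν(a) (ν * ν)(t - a) / ν(t), which has to match - ν(a) ν′(t - a) / ν(t); this is the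
-- origin of ν′ = - ν * ν. The other integral is (ν * ν)(t) / ν(t) = - ν′(t) / ν(t), as the
-- derivative of 1 / ν(t) demands. No analysis is involved. A series is a function on words of
-- variables, giving the iterated derivatives at the origin. Distributing the letters of a word over
-- two subwords is both the Leibniz rule and the distribution of labels over two subtrees, so no
-- binomial coefficients appear. In the variables x = a and y = t - a, deleting the largest label is
-- ∂/∂y, and uniqueness of the solution becomes induction on the number of labels. The alternating
-- signs of ν require integers.

module Series where
  open import Data.Integer.Tactic.RingSolver using (solve-∀)

  -- Opaque, so that unification never unfolds integer arithmetic.
  opaque
    infixl 7 _*_
    infixl 6 _+_ _-_
    infix 8 -_

    _+_ _*_ _-_ : ℤ → ℤ → ℤ
    _+_ = ℤ._+_
    _*_ = ℤ._*_
    _-_ = ℤ._-_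

    -_ : ℤ → ℤ
    -_ = ℤ.-_

    0ℤ 1ℤ : ℤ
    0ℤ = ℤ.0ℤ
    1ℤ = ℤ.1ℤ

    +-comm : ∀ p q → p + q ≡ q + p
    +-comm = ℤ.+-comm

    +-identityˡ : ∀ p → 0ℤ + p ≡ p
    +-identityˡ = ℤ.+-identityˡ

    +-identityʳ : ∀ p → p + 0ℤ ≡ p
    +-identityʳ = ℤ.+-identityʳ

    *-comm : ∀ p q → p * q ≡ q * p
    *-comm = ℤ.*-comm

    *-assoc : ∀ p q r → p * q * r ≡ p * (q * r)
    *-assoc = ℤ.*-assoc

    *-identityˡ : ∀ p → 1ℤ * p ≡ p
    *-identityˡ = ℤ.*-identityˡ

    *-identityʳ : ∀ p → p * 1ℤ ≡ p
    *-identityʳ = ℤ.*-identityʳ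

    *-zeroˡ : ∀ p → 0ℤ * p ≡ 0ℤ
    *-zeroˡ = ℤ.*-zeroˡ

    *-zeroʳ : ∀ p → p * 0ℤ ≡ 0ℤ
    *-zeroʳ = ℤ.*-zeroʳ

    *-distribˡ-+ : ∀ p q r → p * (q + r) ≡ p * q + p * r
    *-distribˡ-+ = ℤ.*-distribˡ-+

    *-distribʳ-+ : ∀ r p q → (p + q) * r ≡ p * r + q * r
    *-distribʳ-+ = ℤ.*-distribʳ-+

    +-assoc : ∀ p q r → p + q + r ≡ p + (q + r)
    +-assoc = ℤ.+-assoc

    +-interchange : ∀ p q r s → (p + q) + (r + s) ≡ (p + r) + (q + s)
    +-interchange = solve-∀

    +-left-comm : ∀ p q r → p + (q + r) ≡ q + (p + r)
    +-left-comm = solve-∀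

    neg-distrib-+ : ∀ p q → - (p + q) ≡ - p + - q
    neg-distrib-+ = ℤ.neg-distrib-+

    neg-distribˡ-* : ∀ p q → - (p * q) ≡ - p * q
    neg-distribˡ-* = ℤ.neg-distribˡ-*

    neg-distribʳ-* : ∀ p q → - (p * q) ≡ p * - q
    neg-distribʳ-* = ℤ.neg-distribʳ-*

    ofℕ : ℕ → ℤ
    ofℕ = ℤ.+_

    ofℕ-0 : ofℕ 0 ≡ 0ℤ
    ofℕ-0 = refl

    ofℕ-suc : ∀ k → ofℕ (suc k) ≡ 1ℤ + ofℕ k
    ofℕ-suc _ = refl

    ofℕ-injective : ∀ {j k} → ofℕ j ≡ ofℕ k → j ≡ k
    ofℕ-injective = ℤ.+-injective

    +-inverseˡ : ∀ p → - p + p ≡ 0ℤ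
    +-inverseˡ = ℤ.+-inverseˡ

    neg-+-comm : ∀ p q → - p + q ≡ q - p
    neg-+-comm p q = ℤ.+-comm (ℤ.- p) q

    +-minus : ∀ p q r → p ≡ q + r → q ≡ p - r
    +-minus = λ { _ q r refl → lemma q r }
      where
      lemma : ∀ q r → q ≡ q ℤ.+ r ℤ.+ ℤ.- r
      lemma = solve-∀

  -- Exponential generating functions on words of variables.

  private variable
    X Y : Set
    f f′ g g′ h : List X → ℤ
    B C : List X → List X → ℤ

  split∑ : (List X → List X → ℤ) → List X → ℤ
  split∑ B []      = B [] []
  split∑ B (x ∷ w) = split∑ (λ a b → B (x ∷ a) b) w + split∑ (λ a b → B a (x ∷ b)) w

  split∑-cong : ∀ (w : List X) → (∀ {a b} → a ⊆ w → b ⊆ w → B a b ≡ C a b) →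
                split∑ B w ≡ split∑ C w
  split∑-cong []      eq = eq [] []
  split∑-cong (x ∷ w) eq = cong₂ _+_
    (split∑-cong w λ p q → eq (refl ∷ p) (x ∷ʳ q))
    (split∑-cong w λ p q → eq (x ∷ʳ p) (refl ∷ q))

  split∑-0 : ∀ (w : List X) → split∑ (λ _ _ → 0ℤ) w ≡ 0ℤ
  split∑-0 []      = refl
  split∑-0 (x ∷ w) = trans (cong₂ _+_ (split∑-0 w) (split∑-0 w)) (+-identityˡ _)

  split∑-zero : ∀ (w : List X) → (∀ {a b} → a ⊆ w → b ⊆ w → B a b ≡ 0ℤ) → split∑ B w ≡ 0ℤ
  split∑-zero w eq = trans (split∑-cong w eq) (split∑-0 w)

  split∑-+ : ∀ (B C : List X → List X → ℤ) w →
             split∑ (λ a b → B a b + C a b) w ≡ split∑ B w + split∑ C w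
  split∑-+ B C []      = refl
  split∑-+ B C (x ∷ w) =
    trans (cong₂ _+_ (split∑-+ _ _ w) (split∑-+ _ _ w)) (+-interchange _ _ _ _)

  split∑-neg : ∀ (B : List X → List X → ℤ) w → split∑ (λ a b → - B a b) w ≡ - split∑ B w
  split∑-neg B []      = refl
  split∑-neg B (x ∷ w) =
    trans (cong₂ _+_ (split∑-neg _ w) (split∑-neg _ w)) (sym (neg-distrib-+ _ _))

  split∑-map : ∀ (φ : X → Y) (B : List Y → List Y → ℤ) w →
               split∑ (λ a b → B (map φ a) (map φ b)) w ≡ split∑ B (map φ w)
  split∑-map φ B []      = refl
  split∑-map φ B (x ∷ w) = cong₂ _+_ (split∑-map φ _ w) (split∑-map φ _ w)

  -- The product of exponential generating functions: a word records the
  -- variables to differentiate by, and the recursion is the Leibniz rule.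
  infixl 7 _⋆_
  _⋆_ : (List X → ℤ) → (List X → ℤ) → List X → ℤ
  f ⋆ g = split∑ λ a b → f a * g b

  δ : List X → ℤ
  δ []      = 1ℤ
  δ (_ ∷ _) = 0ℤ

  ⋆-cong⊆ : ∀ (w : List X) → (∀ {u} → u ⊆ w → f u ≡ f′ u) → (∀ {u} → u ⊆ w → g u ≡ g′ u) →
            (f ⋆ g) w ≡ (f′ ⋆ g′) w
  ⋆-cong⊆ w p q = split∑-cong w λ a b → cong₂ _*_ (p a) (q b)

  ⋆-cong : f ≗ f′ → g ≗ g′ → f ⋆ g ≗ f′ ⋆ g′
  ⋆-cong p q w = ⋆-cong⊆ w (λ {u} _ → p u) (λ {u} _ → q u)

  ⋆-congˡ : ∀ (f : List X → ℤ) → g ≗ g′ → f ⋆ g ≗ f ⋆ g′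
  ⋆-congˡ f = ⋆-cong (λ _ → refl)

  ⋆-congʳ : ∀ (g : List X → ℤ) → f ≗ f′ → f ⋆ g ≗ f′ ⋆ g
  ⋆-congʳ g p = ⋆-cong p (λ _ → refl)

  ⋆-comm : ∀ (f g : List X → ℤ) → f ⋆ g ≗ g ⋆ f
  ⋆-comm f g []      = *-comm (f []) (g [])
  ⋆-comm f g (x ∷ w) =
    trans (cong₂ _+_ (⋆-comm _ g w) (⋆-comm f _ w)) (+-comm _ ((g ∘ (x ∷_) ⋆ f) w))

  ⋆-distribˡ : ∀ (f g h : List X → ℤ) → f ⋆ (λ u → g u + h u) ≗ λ w → (f ⋆ g) w + (f ⋆ h) w
  ⋆-distribˡ f g h w =
    trans (split∑-cong w λ {a} {b} _ _ → *-distribˡ-+ (f a) (g b) (h b)) (split∑-+ _ _ w)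

  ⋆-distribʳ : ∀ (f g h : List X → ℤ) → (λ u → f u + g u) ⋆ h ≗ λ w → (f ⋆ h) w + (g ⋆ h) w
  ⋆-distribʳ f g h w =
    trans (split∑-cong w λ {a} {b} _ _ → *-distribʳ-+ (h b) (f a) (g a)) (split∑-+ _ _ w)

  ⋆-assoc : ∀ (f g h : List X → ℤ) → (f ⋆ g) ⋆ h ≗ f ⋆ (g ⋆ h)
  ⋆-assoc f g h []      = *-assoc (f []) (g []) (h [])
  ⋆-assoc f g h (x ∷ w) = begin
    ((f ⋆ g) ∘ (x ∷_) ⋆ h) w + ((f ⋆ g) ⋆ ∂h) w
      ≡⟨ cong₂ _+_ (⋆-distribʳ (∂f ⋆ g) (f ⋆ ∂g) h w) refl ⟩
    (((∂f ⋆ g) ⋆ h) w + ((f ⋆ ∂g) ⋆ h) w) + ((f ⋆ g) ⋆ ∂h) w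
      ≡⟨ cong₂ _+_ (cong₂ _+_ (⋆-assoc ∂f g h w) (⋆-assoc f ∂g h w)) (⋆-assoc f g ∂h w) ⟩
    ((∂f ⋆ (g ⋆ h)) w + (f ⋆ (∂g ⋆ h)) w) + (f ⋆ (g ⋆ ∂h)) w
      ≡⟨ +-assoc _ _ _ ⟩
    (∂f ⋆ (g ⋆ h)) w + ((f ⋆ (∂g ⋆ h)) w + (f ⋆ (g ⋆ ∂h)) w)
      ≡⟨ cong₂ _+_ refl (⋆-distribˡ f (∂g ⋆ h) (g ⋆ ∂h) w) ⟨
    (∂f ⋆ (g ⋆ h)) w + (f ⋆ (g ⋆ h) ∘ (x ∷_)) w ∎
    where
    open ≡-Reasoning
    ∂f = f ∘ (x ∷_)
    ∂g = g ∘ (x ∷_)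
    ∂h = h ∘ (x ∷_)

  ⋆-identityʳ : ∀ (f : List X → ℤ) → f ⋆ δ ≗ f
  ⋆-identityʳ f []      = *-identityʳ (f [])
  ⋆-identityʳ f (x ∷ w) = trans
    (cong₂ _+_ (⋆-identityʳ _ w) (split∑-zero w λ {a} _ _ → *-zeroʳ (f a)))
    (+-identityʳ _)

  ⋆-identityˡ : ∀ (f : List X → ℤ) → δ ⋆ f ≗ f
  ⋆-identityˡ f w = trans (⋆-comm δ f w) (⋆-identityʳ f w)

  ⋆-map : ∀ (φ : X → Y) (f g : List Y → ℤ) → (f ∘ map φ) ⋆ (g ∘ map φ) ≗ (f ⋆ g) ∘ map φ
  ⋆-map φ f g = split∑-map φ λ a b → f a * g b

  -- Mixed derivatives commute: in the `swap` case the two cross terms trade places.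
  ⋆-resp-↭ : ∀ {u w : List X} → u ↭ w → (∀ {a b} → a ↭ b → f a ≡ f b) →
             (∀ {a b} → a ↭ b → g a ≡ g b) → (f ⋆ g) u ≡ (f ⋆ g) w
  ⋆-resp-↭ refl          p q = refl
  ⋆-resp-↭ (prep x r)    p q = cong₂ _+_
    (⋆-resp-↭ r (p ∘ prep x) q) (⋆-resp-↭ r p (q ∘ prep x))
  ⋆-resp-↭ {f = f} {g = g} {w = y ∷ x ∷ w} (swap x y r) p q = trans
    (cong₂ _+_
      (cong₂ _+_ (⋆-resp-↭ r (p ∘ prep x ∘ prep y) q) (⋆-resp-↭ r (p ∘ prep x) (q ∘ prep y)))
      (cong₂ _+_ (⋆-resp-↭ r (p ∘ prep y) (q ∘ prep x)) (⋆-resp-↭ r p (q ∘ prep x ∘ prep y))))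
    (trans (+-interchange _ _ _ _)
      (cong₂ _+_
        (cong (_+ (f ∘ (y ∷_) ⋆ g ∘ (x ∷_)) w) (⋆-congʳ g (λ _ → p (swap x y refl)) w))
        (cong ((f ∘ (x ∷_) ⋆ g ∘ (y ∷_)) w +_) (⋆-congˡ f (λ _ → q (swap x y refl)) w))))
  ⋆-resp-↭ (↭-chain r r′)  p q = trans (⋆-resp-↭ r p q) (⋆-resp-↭ r′ p q)

  -- Integrals and power series solutions of differential equations.

  when : Bool → ℤ → ℤ
  when b z = if b then z else 0ℤ

  -- Integration over the position of a point, summing over the letters of the
  -- word that can carry it: letters before the point are relabelled by up, those
  -- after it by down, and the letter at the point is removed.
  module Integration (mark : X → Bool) (up down : X → Y) where

    ∫ : (List Y → ℤ) → List X → ℤ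
    ∫ H []      = 0ℤ
    ∫ H (x ∷ w) = when (mark x) (H (map down w)) + ∫ (H ∘ (up x ∷_)) w

    ∫-cong≤ : ∀ {H K} w → (∀ u → length u ≤ length w → H u ≡ K u) → ∫ H w ≡ ∫ K w
    ∫-cong≤ []      eq = refl
    ∫-cong≤ (x ∷ w) eq = cong₂ _+_
      (cong (when (mark x)) (eq (map down w) (≤-trans (≤-reflexive (length-map down w)) (n≤1+n _))))
      (∫-cong≤ w λ u p → eq (up x ∷ u) (s≤s p))

    ∫-cong : ∀ {H K} → H ≗ K → ∫ H ≗ ∫ K
    ∫-cong eq w = ∫-cong≤ w λ u _ → eq u

    ∫-+ : ∀ H K w → ∫ (λ u → H u + K u) w ≡ ∫ H w + ∫ K w
    ∫-+ H K []      = sym (+-identityˡ _)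
    ∫-+ H K (x ∷ w) with mark x
    ... | true  = trans (cong₂ _+_ refl (∫-+ _ _ w)) (+-interchange _ _ _ _)
    ... | false = trans (cong₂ _+_ refl (∫-+ _ _ w)) (trans (cong₂ _+_ (sym (+-identityˡ 0ℤ)) refl) (+-interchange _ _ _ _))

    -- A factor that does not depend on the integration variable moves under the integral; `π`
    -- forgets on which side of the point a letter lies.
    ⋆-∫ : ∀ {π : Y → X} → π ∘ up ≗ id → π ∘ down ≗ id →
          ∀ f H → f ⋆ ∫ H ≗ ∫ (f ∘ map π ⋆ H)
    ⋆-∫ πup πdown f H []      = *-zeroʳ (f [])
    ⋆-∫ {π} πup πdown f H (x ∷ w) = begin
      (∂f ⋆ ∫ H) w + (f ⋆ (λ u → when (mark x) (H (map down u)) + ∫ ∂H u)) w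
        ≡⟨ cong ((∂f ⋆ ∫ H) w +_) (⋆-distribˡ f (λ u → when (mark x) (H (map down u))) (∫ ∂H) w) ⟩
      (∂f ⋆ ∫ H) w + ((f ⋆ (λ u → when (mark x) (H (map down u)))) w + (f ⋆ ∫ ∂H) w)
        ≡⟨ cong₂ _+_ (⋆-∫ πup πdown ∂f H w) (cong₂ _+_ marked (⋆-∫ πup πdown f ∂H w)) ⟩
      ∫ (∂f ∘ map π ⋆ H) w + (when (mark x) ((f ∘ map π ⋆ H) (map down w)) + ∫ (f ∘ map π ⋆ ∂H) w)
        ≡⟨ +-left-comm _ _ _ ⟩
      when (mark x) ((f ∘ map π ⋆ H) (map down w)) + (∫ (∂f ∘ map π ⋆ H) w + ∫ (f ∘ map π ⋆ ∂H) w)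
        ≡⟨ cong (when (mark x) _ +_) (∫-+ (∂f ∘ map π ⋆ H) (f ∘ map π ⋆ ∂H) w) ⟨
      when (mark x) ((f ∘ map π ⋆ H) (map down w)) + ∫ (λ u → (∂f ∘ map π ⋆ H) u + (f ∘ map π ⋆ ∂H) u) w
        ≡⟨ cong (when (mark x) _ +_) (∫-cong (λ u → cong₂ _+_
             (⋆-congʳ H (λ a → cong (λ y → f (y ∷ map π a)) (sym (πup x))) u) refl) w) ⟩
      when (mark x) ((f ∘ map π ⋆ H) (map down w)) + ∫ ((f ∘ map π ⋆ H) ∘ (up x ∷_)) w ∎
      where
      open ≡-Reasoning
      ∂f = f ∘ (x ∷_)
      ∂H = H ∘ (up x ∷_)
      π-down : ∀ u → map π (map down u) ≡ u
      π-down u = trans (sym (map-∘ u)) (trans (map-cong πdown u) (map-id u))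
      marked : (f ⋆ (λ u → when (mark x) (H (map down u)))) w ≡ when (mark x) ((f ∘ map π ⋆ H) (map down w))
      marked with mark x
      ... | true  = trans (⋆-congʳ (H ∘ map down) (λ a → cong f (sym (π-down a))) w)
                          (⋆-map down (f ∘ map π) H w)
      ... | false = split∑-zero w λ {a} _ _ → *-zeroʳ (f a)

  -- Power series solutions of f′ = Φ f, f(0) = 1.
  module Solve (Φ : (List ⊤ → ℤ) → List ⊤ → ℤ)
               (causal : ∀ {f g} w → (∀ u → length u ≤ length w → f u ≡ g u) → Φ f w ≡ Φ g w)
    where

    approx : ℕ → List ⊤ → ℤ
    approx zero    _       = 1ℤ
    approx (suc k) []      = 1ℤ
    approx (suc k) (_ ∷ w) = Φ (approx k) w

    solution : List ⊤ → ℤ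
    solution w = approx (length w) w

    -- Each application of `Φ` settles the coefficients of one more order, so every depth that is at
    -- least the length of the word gives the same value.
    approx-stable : ∀ j k w → length w ≤ j → length w ≤ k → approx j w ≡ approx k w
    approx-stable zero    zero    []      p q = refl
    approx-stable zero    (suc k) []      p q = refl
    approx-stable (suc j) zero    []      p q = refl
    approx-stable (suc j) (suc k) []      p q = refl
    approx-stable (suc j) (suc k) (_ ∷ w) (s≤s p) (s≤s q) =
      causal w λ u u≤w → approx-stable j k u (≤-trans u≤w p) (≤-trans u≤w q)

    solution-step : ∀ w → solution (tt ∷ w) ≡ Φ solution w
    solution-step w = causal w λ u u≤w → approx-stable (length w) (length u) u u≤w ≤-refl

  -- The series `ν`, its inverse `μ` and the symmetric function `γ`.

  data Two : Set where
    above below : Two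

  -- The position of a label relative to the first labels a of a left tree and b
  -- of a right tree, when all left labels are below b: above b, between a and b,
  -- or below a. A left label (see lo) is never above b, and a right label (see
  -- hi) is only compared with b.
  data Three : Set where
    above between below : Three

  flat : List X → List ⊤
  flat = map (const tt)

  δ-flat : ∀ (u : List X) → δ (flat u) ≡ δ u
  δ-flat []      = refl
  δ-flat (_ ∷ u) = refl

  isAbove isBelow : Two → Maybe ⊤
  isAbove above = just tt
  isAbove below = nothing
  isBelow above = nothing
  isBelow below = just tt

  aboves belows : List Two → List ⊤
  aboves = mapMaybe isAbove
  belows = mapMaybe isBelow

  infixr 8 _⊗_
  _⊗_ : (List ⊤ → ℤ) → (List ⊤ → ℤ) → List Two → ℤ
  (f ⊗ g) w = f (aboves w) * g (belows w)

  open Integration {X = ⊤} {Y = Two} (const true) (const above) (const below) public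
    using () renaming (∫ to ∫₁; ∫-cong to ∫₁-cong; ∫-cong≤ to ∫₁-cong≤; ⋆-∫ to ⋆-∫₁)

  private
    κ-causal : ∀ {f g} w → (∀ u → length u ≤ length w → f u ≡ g u) →
               - ∫₁ (f ⊗ f) w ≡ - ∫₁ (g ⊗ g) w
    κ-causal w eq = cong -_ (∫₁-cong≤ w λ u u≤w → cong₂ _*_
      (eq _ (≤-trans (length-mapMaybe isAbove u) u≤w))
      (eq _ (≤-trans (length-mapMaybe isBelow u) u≤w)))

  -- ν(t) = ∑ₖ (-1)ᵏ Cₖ t²ᵏ / (2k)! with Cₖ the Catalan numbers, that is, the
  -- solution of ν′ = - ν * ν with ν(0) = 1.
  ν κ : List ⊤ → ℤ
  ν = Solve.solution (λ f w → - ∫₁ (f ⊗ f) w) κ-causal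
  κ = ∫₁ (ν ⊗ ν)

  -- Convolving tⁱ / i! with tʲ / j! gives t to the power i + j + 1 over (i + j + 1)!. In
  -- coefficients the equation is thus a shifted Cauchy product with a minus sign, the source of the
  -- signed Catalan numbers.
  ν-step : ∀ w → ν (tt ∷ w) ≡ - κ w
  ν-step = Solve.solution-step (λ f w → - ∫₁ (f ⊗ f) w) κ-causal

  private
    μ-causal : ∀ {f g} w → (∀ u → length u ≤ length w → f u ≡ g u) →
               ((f ⋆ f) ⋆ κ) w ≡ ((g ⋆ g) ⋆ κ) w
    μ-causal w eq = ⋆-cong⊆ w
      (λ {u} u⊆w → ⋆-cong⊆ u (λ p → short (length-mono-≤ u⊆w) p) (λ p → short (length-mono-≤ u⊆w) p))
      (λ _ → refl)
      where
      short : ∀ {u v} → length u ≤ length w → v ⊆ u → _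
      short p q = eq _ (≤-trans (length-mono-≤ q) p)

  -- μ = 1 / ν, by μ′ = - μ² ν′ = μ² κ.
  μ : List ⊤ → ℤ
  μ = Solve.solution (λ f → (f ⋆ f) ⋆ κ) μ-causal

  μ-step : ∀ w → μ (tt ∷ w) ≡ ((μ ⋆ μ) ⋆ κ) w
  μ-step = Solve.solution-step (λ f → (f ⋆ f) ⋆ κ) μ-causal

  -- The derivative of ν μ is - κ μ + ν μ² κ. It vanishes in a given order once ν μ = 1 holds up to
  -- that order, hence the induction on the length.
  ν⋆μ : ν ⋆ μ ≗ δ
  ν⋆μ w = go (length w) w ≤-refl
    where
    open ≡-Reasoning
    go : ∀ k w → length w ≤ k → (ν ⋆ μ) w ≡ δ w
    go k       []       _       = *-identityˡ 1ℤ
    go (suc k) (tt ∷ w) (s≤s p) = begin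
      (ν ∘ (tt ∷_) ⋆ μ) w + (ν ⋆ μ ∘ (tt ∷_)) w
        ≡⟨ cong₂ _+_ (⋆-congʳ μ ν-step w) (⋆-congˡ ν μ-step w) ⟩
      ((λ u → - κ u) ⋆ μ) w + (ν ⋆ ((μ ⋆ μ) ⋆ κ)) w
        ≡⟨ cong₂ _+_
             (trans (split∑-cong w λ {a} {b} _ _ → sym (neg-distribˡ-* (κ a) (μ b))) (split∑-neg _ w))
             (trans (⋆-congˡ ν (⋆-assoc μ μ κ) w) (sym (⋆-assoc ν μ (μ ⋆ κ) w))) ⟩
      - (κ ⋆ μ) w + ((ν ⋆ μ) ⋆ (μ ⋆ κ)) w
        ≡⟨ cong₂ (λ p q → - p + q) (⋆-comm κ μ w)
             (trans (⋆-cong⊆ w (λ {u} u⊆w → go k u (≤-trans (length-mono-≤ u⊆w) p)) (λ _ → refl))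
                    (⋆-identityˡ (μ ⋆ κ) w)) ⟩
      - (μ ⋆ κ) w + (μ ⋆ κ) w
        ≡⟨ +-inverseˡ _ ⟩
      0ℤ ∎

  -- γ = ν(x) ν(y) / ν(x + y) with y marked by above and x by below.
  γ : List Two → ℤ
  γ = (ν ⊗ ν) ⋆ (μ ∘ flat)

  -- Only the numbers of `above` and `below` letters matter. `γ-sym` needs this because flipping a
  -- `tag` word leaves the `below` letters in front.
  γ-resp-↭ : ∀ {u w} → u ↭ w → γ u ≡ γ w
  γ-resp-↭ r = ⋆-resp-↭ r
    (λ q → cong₂ _*_ (cong ν (⊤-↭ (mapMaybe-↭ isAbove q))) (cong ν (⊤-↭ (mapMaybe-↭ isBelow q))))
    (λ q → cong μ (⊤-↭ (↭-map⁺ _ q)))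
    where
    ⊤-↭ : ∀ {u w : List ⊤} → u ↭ w → u ≡ w
    ⊤-↭ refl         = refl
    ⊤-↭ (prep x r)   = cong (tt ∷_) (⊤-↭ r)
    ⊤-↭ (swap x y r) = cong (λ w → tt ∷ tt ∷ w) (⊤-↭ r)
    ⊤-↭ (↭-chain r r′) = trans (⊤-↭ r) (⊤-↭ r′)

  flip : Two → Two
  flip above = below
  flip below = above

  γ-flip : ∀ w → γ (map flip w) ≡ γ w
  γ-flip w = trans (sym (⋆-map flip (ν ⊗ ν) (μ ∘ flat) w))
    (⋆-cong (λ u → trans (cong₂ _*_ (cong ν (above-flip u)) (cong ν (below-flip u))) (*-comm (ν (belows u)) _))
            (λ u → cong μ (sym (map-∘ u))) w)
    where
    above-flip : ∀ u → aboves (map flip u) ≡ belows u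
    above-flip []          = refl
    above-flip (above ∷ u) = above-flip u
    above-flip (below ∷ u) = cong (tt ∷_) (above-flip u)
    below-flip : ∀ u → belows (map flip u) ≡ aboves u
    below-flip []          = refl
    below-flip (above ∷ u) = cong (tt ∷_) (below-flip u)
    below-flip (below ∷ u) = below-flip u

  tag : List X → List Y → List Two
  tag U V = map (const above) U ++ map (const below) V

  γ-sym : ∀ (U : List X) (V : List Y) → γ (tag U V) ≡ γ (tag V U)
  γ-sym U V = begin
    γ (tag U V)                                       ≡⟨ γ-flip (tag U V) ⟨
    γ (map flip (tag U V))                            ≡⟨ cong γ (map-++ flip (map (const above) U) _) ⟩
    γ (map flip (map (const above) U) ++ map flip (map (const below) V))
      ≡⟨ cong₂ (λ u w → γ (u ++ w)) (map-∘ U) (map-∘ V) ⟨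
    γ (map (const below) U ++ map (const above) V)
      ≡⟨ γ-resp-↭ (++-comm (map (const below) U) _) ⟩
    γ (tag V U) ∎
    where open ≡-Reasoning

  -- The initial condition P(a, a) = 1: at y = 0 the quotient is ν(x) ν(0) / ν(x). For trees, the
  -- leftmost leaf is the largest label only if it is the whole tree.
  γ-below : ∀ (V : List X) → γ (map (const below) V) ≡ δ V
  γ-below V = trans (sym (⋆-map (const below) (ν ⊗ ν) (μ ∘ flat) V))
    (trans (⋆-cong (λ u → trans (cong₂ _*_ (cong ν (no-aboves u)) (cong ν (all-below u))) (*-identityˡ _))
                   (λ u → cong μ (sym (map-∘ u))) V)
    (trans (⋆-map (const tt) ν μ V) (trans (ν⋆μ (flat V)) (δ-flat V))))
    where
    no-aboves : ∀ (u : List X) → aboves (map (const below) u) ≡ []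
    no-aboves []      = refl
    no-aboves (_ ∷ u) = no-aboves u
    all-below : ∀ (u : List X) → belows (map (const below) u) ≡ flat u
    all-below []      = refl
    all-below (_ ∷ u) = cong (tt ∷_) (all-below u)

  -- The differential equation satisfied by `γ`.

  ρ : List ⊤ → ℤ
  ρ = ∫₁ γ

  -- `ρ` is ∫₀ᵗ P(b, t) db; the factor 1 / ν(t) does not depend on b, and a convolution of ν with
  -- itself remains.
  ρ≗μ⋆κ : ρ ≗ μ ⋆ κ
  ρ≗μ⋆κ w = trans (∫₁-cong (⋆-comm (ν ⊗ ν) (μ ∘ flat)) w)
    (sym (⋆-∫₁ {π = const tt} (λ _ → refl) (λ _ → refl) μ (ν ⊗ ν) w))

  isMarked : Two → Bool
  isMarked above = true
  isMarked below = false

  -- New marks once a letter above a becomes the point b: `upper` for letters listed before it,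
  -- which are larger in a decreasing list, and `lower` for those after it.
  upper lower : Two → Three
  upper above = above
  upper below = below
  lower above = between
  lower below = below

  open Integration isMarked upper lower public
    using () renaming (∫ to ∫₂; ∫-cong to ∫₂-cong; ⋆-∫ to ⋆-∫₂)

  isTop isBottom : Three → Maybe ⊤
  isTop above    = just tt
  isTop between  = nothing
  isTop below    = nothing
  isBottom above   = nothing
  isBottom between = nothing
  isBottom below   = just tt

  notTop notBottom : Three → Maybe Two
  notTop above   = nothing
  notTop between = just above
  notTop below   = just below
  notBottom above   = just above
  notBottom between = just below
  notBottom below   = nothing

  merge : Three → Two
  merge above   = above
  merge between = below
  merge below   = below

  tops bottoms : List Three → List ⊤
  tops    = mapMaybe isTop
  bottoms = mapMaybe isBottom

  topless bottomless : List Three → List Two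
  topless    = mapMaybe notTop
  bottomless = mapMaybe notBottom

  -- The factor `δ (tops a)` sends every letter above the point to the right side, so these letters
  -- separate from the product.
  ⋆-topless : ∀ (φ : List ⊤ → ℤ) f h u →
    ((λ a → δ (tops a) * f (topless a)) ⋆ (λ b → φ (tops b) * h (topless b))) u ≡
    φ (tops u) * (f ⋆ h) (topless u)
  ⋆-topless φ f h []            = trans (cong (_* _) (*-identityˡ (f [])))
    (trans (sym (*-assoc _ _ _)) (trans (cong (_* h []) (*-comm (f []) _)) (*-assoc _ _ _)))
  ⋆-topless φ f h (above ∷ u)   = trans
    (cong₂ _+_ (split∑-zero u λ _ _ → trans (cong (_* _) (*-zeroˡ _)) (*-zeroˡ _)) (⋆-topless (φ ∘ (tt ∷_)) f h u))
    (+-identityˡ _)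
  ⋆-topless φ f h (between ∷ u) = trans
    (cong₂ _+_ (⋆-topless φ (f ∘ (above ∷_)) h u) (⋆-topless φ f (h ∘ (above ∷_)) u))
    (sym (*-distribˡ-+ _ _ _))
  ⋆-topless φ f h (below ∷ u)   = trans
    (cong₂ _+_ (⋆-topless φ (f ∘ (below ∷_)) h u) (⋆-topless φ f (h ∘ (below ∷_)) u))
    (sym (*-distribˡ-+ _ _ _))

  -- Letters below a cannot carry the point, so their factor is constant under the integral from a
  -- to t; the rest is an integral over an interval of length t - a.
  ∫₂-bottomless : ∀ (K : List Two → ℤ) ψ w →
    ∫₂ (λ u → K (bottomless u) * ψ (bottoms u)) w ≡ ∫₁ K (aboves w) * ψ (belows w)
  ∫₂-bottomless K ψ []          = sym (*-zeroˡ _)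
  ∫₂-bottomless K ψ (above ∷ w) = trans
    (cong₂ _+_ (cong₂ (λ a b → K a * ψ b) (lower-bottomless w) (lower-bottoms w))
               (∫₂-bottomless (K ∘ (above ∷_)) ψ w))
    (sym (*-distribʳ-+ _ _ _))
    where
    lower-bottomless : ∀ w → bottomless (map lower w) ≡ map (const below) (aboves w)
    lower-bottomless []          = refl
    lower-bottomless (above ∷ w) = cong (below ∷_) (lower-bottomless w)
    lower-bottomless (below ∷ w) = lower-bottomless w
    lower-bottoms : ∀ w → bottoms (map lower w) ≡ belows w
    lower-bottoms []          = refl
    lower-bottoms (above ∷ w) = lower-bottoms w
    lower-bottoms (below ∷ w) = cong (tt ∷_) (lower-bottoms w)
  ∫₂-bottomless K ψ (below ∷ w) = trans (+-identityˡ _) (∫₂-bottomless K (ψ ∘ (tt ∷_)) w)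

  -- For `f = γ` these are P(a, u) and P(u, t) in the variables a, u - a and t - u, which `below`,
  -- `between` and `above` stand for.
  lo hi : (List Two → ℤ) → List Three → ℤ
  lo f u = δ (tops u) * f (topless u)
  hi f u = f (map merge u)

  μ̂ : List X → ℤ
  μ̂ = μ ∘ flat

  γ⋆ν : γ ⋆ (ν ∘ flat) ≗ ν ⊗ ν
  γ⋆ν w = trans (⋆-assoc (ν ⊗ ν) μ̂ (ν ∘ flat) w)
    (trans (⋆-congˡ (ν ⊗ ν) (λ u → trans (⋆-map (const tt) μ ν u)
              (trans (⋆-comm μ ν (flat u)) (trans (ν⋆μ (flat u)) (δ-flat u)))) w)
           (⋆-identityʳ (ν ⊗ ν) w))

  -- The factor 1 / ν(t) of P(u, t) does not depend on u and is moved out, and ν(u) cancels against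
  -- the denominator of P(a, u). The remaining ν(a) ν(u - a) ν(t - u) integrates over [a, t] to ν(a)
  -- κ(t - a).
  bad-pairs : ∫₂ (lo γ ⋆ hi γ) ≗ μ̂ ⋆ (κ ⊗ ν)
  bad-pairs w = begin
    ∫₂ (lo γ ⋆ hi γ) w
      ≡⟨ ∫₂-cong (λ u → begin
           (lo γ ⋆ hi γ) u
             ≡⟨ ⋆-congˡ (lo γ) (λ a → trans (sym (⋆-map merge (ν ⊗ ν) μ̂ a))
                  (⋆-cong merged (λ b → cong μ (sym (map-∘ b))) a)) u ⟩
           (lo γ ⋆ (nn ⋆ μ̂)) u
             ≡⟨ trans (sym (⋆-assoc (lo γ) nn μ̂ u)) (⋆-comm (lo γ ⋆ nn) μ̂ u) ⟩
           (μ̂ ⋆ (lo γ ⋆ nn)) u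
             ≡⟨ ⋆-cong (λ a → cong μ (map-∘ a)) (λ a → trans (⋆-topless ν γ (ν ∘ flat) a) (
                  trans (cong (ν (tops a) *_) (γ⋆ν (topless a))) (regroup a))) u ⟩
           (μ̂ ∘ map π ⋆ (λ a → (ν ⊗ ν) (bottomless a) * ν (bottoms a))) u ∎) w ⟩
    ∫₂ (μ̂ ∘ map π ⋆ (λ a → (ν ⊗ ν) (bottomless a) * ν (bottoms a))) w
      ≡⟨ ⋆-∫₂ {π = π} (λ { above → refl ; below → refl }) (λ { above → refl ; below → refl }) μ̂ _ w ⟨
    (μ̂ ⋆ ∫₂ (λ a → (ν ⊗ ν) (bottomless a) * ν (bottoms a))) w
      ≡⟨ ⋆-congˡ μ̂ (∫₂-bottomless (ν ⊗ ν) ν) w ⟩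
    (μ̂ ⋆ (κ ⊗ ν)) w ∎
    where
    open ≡-Reasoning
    π : Three → Two
    π above   = above
    π between = above
    π below   = below
    -- The numerator ν(t - u) ν(u) of P(u, t): the letters below u are those of `topless`.
    nn : List Three → ℤ
    nn u = ν (tops u) * ν (flat (topless u))
    merged : ∀ u → (ν ⊗ ν) (map merge u) ≡ nn u
    merged u = cong₂ _*_ (cong ν (aboves-merge u)) (cong ν (belows-merge u))
      where
      aboves-merge : ∀ u → aboves (map merge u) ≡ tops u
      aboves-merge []            = refl
      aboves-merge (above ∷ u)   = cong (tt ∷_) (aboves-merge u)
      aboves-merge (between ∷ u) = aboves-merge u
      aboves-merge (below ∷ u)   = aboves-merge u
      belows-merge : ∀ u → belows (map merge u) ≡ flat (topless u)
      belows-merge []            = refl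
      belows-merge (above ∷ u)   = belows-merge u
      belows-merge (between ∷ u) = cong (tt ∷_) (belows-merge u)
      belows-merge (below ∷ u)   = cong (tt ∷_) (belows-merge u)
    regroup : ∀ u → ν (tops u) * (ν ⊗ ν) (topless u) ≡ (ν ⊗ ν) (bottomless u) * ν (bottoms u)
    regroup u = trans (sym (*-assoc _ _ _))
      (cong₂ _*_ (cong₂ _*_ (cong ν (tops-bottomless u)) (cong ν (middle u))) (cong ν (belows-topless u)))
      where
      tops-bottomless : ∀ u → tops u ≡ aboves (bottomless u)
      tops-bottomless []            = refl
      tops-bottomless (above ∷ u)   = cong (tt ∷_) (tops-bottomless u)
      tops-bottomless (between ∷ u) = tops-bottomless u
      tops-bottomless (below ∷ u)   = tops-bottomless u
      middle : ∀ u → aboves (topless u) ≡ belows (bottomless u)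
      middle []            = refl
      middle (above ∷ u)   = middle u
      middle (between ∷ u) = cong (tt ∷_) (middle u)
      middle (below ∷ u)   = middle u
      belows-topless : ∀ u → belows (topless u) ≡ bottoms u
      belows-topless []            = refl
      belows-topless (above ∷ u)   = belows-topless u
      belows-topless (between ∷ u) = belows-topless u
      belows-topless (below ∷ u)   = cong (tt ∷_) (belows-topless u)

  -- The product rule in y for ν(x) ν(y) / ν(x + y): differentiating ν(y) produces the subtracted
  -- integral, differentiating 1 / ν(x + y) the product of P with ∫₀ᵗ P(b, t) db.
  γ-above : ∀ w → γ (above ∷ w) ≡ (γ ⋆ (ρ ∘ flat)) w - ∫₂ (lo γ ⋆ hi γ) w
  γ-above w = begin
    ((ν ⊗ ν) ∘ (above ∷_) ⋆ μ̂) w + ((ν ⊗ ν) ⋆ μ̂ ∘ (above ∷_)) w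
      ≡⟨ cong₂ _+_ first second ⟩
    - (μ̂ ⋆ (κ ⊗ ν)) w + (γ ⋆ (ρ ∘ flat)) w
      ≡⟨ trans (neg-+-comm _ _) (cong (λ z → (γ ⋆ (ρ ∘ flat)) w - z) (sym (bad-pairs w))) ⟩
    (γ ⋆ (ρ ∘ flat)) w - ∫₂ (lo γ ⋆ hi γ) w ∎
    where
    open ≡-Reasoning
    first : ((ν ⊗ ν) ∘ (above ∷_) ⋆ μ̂) w ≡ - (μ̂ ⋆ (κ ⊗ ν)) w
    first = begin
      ((ν ⊗ ν) ∘ (above ∷_) ⋆ μ̂) w
        ≡⟨ ⋆-comm _ μ̂ w ⟩
      (μ̂ ⋆ (ν ⊗ ν) ∘ (above ∷_)) w
        ≡⟨ split∑-cong w (λ {a} {b} _ _ → trans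
             (cong (μ̂ a *_) (trans (cong (_* ν (belows b)) (ν-step (aboves b))) (sym (neg-distribˡ-* _ _))))
             (sym (neg-distribʳ-* (μ̂ a) _))) ⟩
      split∑ (λ a b → - (μ̂ a * (κ ⊗ ν) b)) w
        ≡⟨ split∑-neg _ w ⟩
      - (μ̂ ⋆ (κ ⊗ ν)) w ∎
    second : ((ν ⊗ ν) ⋆ μ̂ ∘ (above ∷_)) w ≡ (γ ⋆ (ρ ∘ flat)) w
    second = begin
      ((ν ⊗ ν) ⋆ μ̂ ∘ (above ∷_)) w
        ≡⟨ ⋆-congˡ (ν ⊗ ν) (λ u → begin
             μ (tt ∷ flat u)              ≡⟨ μ-step (flat u) ⟩
             ((μ ⋆ μ) ⋆ κ) (flat u)       ≡⟨ ⋆-assoc μ μ κ (flat u) ⟩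
             (μ ⋆ (μ ⋆ κ)) (flat u)       ≡⟨ ⋆-congˡ μ ρ≗μ⋆κ (flat u) ⟨
             (μ ⋆ ρ) (flat u)             ≡⟨ ⋆-map (const tt) μ ρ u ⟨
             (μ̂ ⋆ (ρ ∘ flat)) u           ∎) w ⟩
      ((ν ⊗ ν) ⋆ (μ̂ ⋆ (ρ ∘ flat))) w
        ≡⟨ ⋆-assoc (ν ⊗ ν) μ̂ (ρ ∘ flat) w ⟨
      (γ ⋆ (ρ ∘ flat)) w ∎

-- Good trees and their enumeration by label set.

module Enumeration where
  open Series

  private variable
    T : Set

  zeroˡ-* : ∀ {p q} → p ≡ 0ℤ → p * q ≡ 0ℤ
  zeroˡ-* {q = q} eq = trans (cong (_* q) eq) (*-zeroˡ q)

  data Tree : Set where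
    nil  : Tree
    node : Tree → ℕ → Tree → Tree

  inorder : Tree → List ℕ
  inorder nil          = []
  inorder (node l m r) = inorder l ++ m ∷ inorder r

  root : Tree → ℕ
  root nil          = 0
  root (node _ m _) = m

  -- The leftmost leaf of a good tree; junk on other trees.
  first : Tree → ℕ
  first nil                       = 0
  first (node nil m _)            = m
  first (node l@(node _ _ _) _ _) = first l

  data Good : Tree → Set where
    leaf : ∀ {m} → Good (node nil m nil)
    node : ∀ {l m r} → Good l → Good r → first r < root l → root l < m → root r < m →
           Good (node l m r)

  first-node : ∀ {l m r} → Good l → first (node l m r) ≡ first l
  first-node leaf             = refl
  first-node (node _ _ _ _ _) = refl

  root∈ : ∀ {t} → Good t → root t ∈ inorder t
  root∈ leaf                         = here refl
  root∈ (node {l = l} _ _ _ _ _) = ∈-++⁺ʳ (inorder l) (here refl)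

  first∈ : ∀ {t} → Good t → first t ∈ inorder t
  first∈ leaf                           = here refl
  first∈ (node {l = l} {m} {r} p _ _ _ _) =
    subst (_∈ inorder l ++ m ∷ inorder r) (sym (first-node {m = m} {r} p)) (∈-++⁺ˡ (first∈ p))

  Decreasing : List ℕ → Set
  Decreasing = AllPairs _>_

  Decreasing-⊆ : ∀ {L M} → L ⊆ M → Decreasing M → Decreasing L
  Decreasing-⊆ []         d       = d
  Decreasing-⊆ (_ ∷ʳ p)   (_ ∷ d) = Decreasing-⊆ p d
  Decreasing-⊆ (refl ∷ p) (q ∷ d) = All-resp-⊆ p q ∷ Decreasing-⊆ p d

  -- The list version of `split∑`. Both parts keep the order of the list, so parts of a decreasing
  -- list are decreasing and start with their maxima.
  splits : (List ℕ → List ℕ → List T) → List ℕ → List T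
  splits B []      = B [] []
  splits B (x ∷ w) = splits (λ a b → B (x ∷ a) b) w ++ splits (λ a b → B a (x ∷ b)) w

  ∈-splits⁻ : ∀ {t : T} B L → t ∈ splits B L →
              ∃₂ λ X Y → (X ⊆ L × Y ⊆ L) × X ++ Y ↭ L × t ∈ B X Y
  ∈-splits⁻ B []      p = [] , [] , ([] , []) , refl , p
  ∈-splits⁻ B (x ∷ L) p with ∈-++⁻ (splits (λ a b → B (x ∷ a) b) L) p
  ... | inj₁ q with ∈-splits⁻ _ L q
  ...   | X , Y , (i , j) , e , r = x ∷ X , Y , (refl ∷ i , x ∷ʳ j) , prep x e , r
  ∈-splits⁻ B (x ∷ L) p | inj₂ q with ∈-splits⁻ _ L q
  ...   | X , Y , (i , j) , e , r = X , x ∷ Y , (x ∷ʳ i , refl ∷ j) , ↭-trans (shift x X Y) (prep x e) , r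

  top : List ℕ → ℕ
  top []      = 0
  top (m ∷ _) = m

  singleton : ℕ → List ℕ → List Tree
  singleton m []      = [ node nil m nil ]
  singleton m (_ ∷ _) = []

  -- The first argument is fuel, since the recursive calls are on sublists chosen by `splits`; it
  -- suffices when it is at least the number of labels. The condition on the left root is tested
  -- against `top X`, the root of every good tree with label list `X`.
  goods : ℕ → List ℕ → List Tree
  goods _       []      = []
  goods zero    (_ ∷ _) = []
  goods (suc k) (m ∷ L) = singleton m L ++ splits (λ X Y →
    cartesianProductWith (λ l r → node l m r) (goods k X) (filter (λ r → first r <? top X) (goods k Y))) L

  goods-sound : ∀ k L {t} → Decreasing L → t ∈ goods k L →
                Good t × inorder t ↭ L × root t ≡ top L
  goods-sound (suc k) (m ∷ L) (m> ∷ d) p with ∈-++⁻ (singleton m L) p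
  goods-sound (suc k) (m ∷ []) (m> ∷ d) p | inj₁ (here refl) = leaf , refl , refl
  goods-sound (suc k) (m ∷ L) (m> ∷ d) p | inj₂ q with ∈-splits⁻ _ L q
  ... | X , Y , (X⊆ , Y⊆) , e , q′
    with ∈-cartesianProductWith⁻ (λ l r → node l m r) (goods k X) (filter (λ r → first r <? top X) (goods k Y)) q′
  ... | l , r , l∈ , r∈ , refl
    with goods-sound k X (Decreasing-⊆ X⊆ d) l∈ | ∈-filter⁻ (λ r → first r <? top X) {xs = goods k Y} r∈
  ... | gl , el , rl | r∈′ , fr
    with goods-sound k Y (Decreasing-⊆ Y⊆ d) r∈′
  ... | gr , er , rr =
    node gl gr (subst (first r <_) (sym rl) fr)
      (All.lookup m> (lookup X⊆ (∈-resp-↭ el (root∈ gl))))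
      (All.lookup m> (lookup Y⊆ (∈-resp-↭ er (root∈ gr)))) ,
    ↭-trans (shift m (inorder l) (inorder r)) (prep m (↭-trans (↭-++⁺ el er) e)) , refl

  -- Finite sums over lists.

  ∑ : (T → ℤ) → List T → ℤ
  ∑ f []       = 0ℤ
  ∑ f (x ∷ xs) = f x + ∑ f xs

  ∑-cong : ∀ {f g : T → ℤ} xs → (∀ {x} → x ∈ xs → f x ≡ g x) → ∑ f xs ≡ ∑ g xs
  ∑-cong []       eq = refl
  ∑-cong (x ∷ xs) eq = cong₂ _+_ (eq (here refl)) (∑-cong xs (eq ∘ there))

  ∑-0 : ∀ (xs : List T) → ∑ (λ _ → 0ℤ) xs ≡ 0ℤ
  ∑-0 []       = refl
  ∑-0 (x ∷ xs) = trans (+-identityˡ _) (∑-0 xs)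

  ∑-zero : ∀ {f : T → ℤ} xs → (∀ {x} → x ∈ xs → f x ≡ 0ℤ) → ∑ f xs ≡ 0ℤ
  ∑-zero xs eq = trans (∑-cong xs eq) (∑-0 xs)

  ∑-+ : ∀ (f g : T → ℤ) xs → ∑ (λ x → f x + g x) xs ≡ ∑ f xs + ∑ g xs
  ∑-+ f g []       = sym (+-identityˡ _)
  ∑-+ f g (x ∷ xs) = trans (cong₂ _+_ refl (∑-+ f g xs)) (+-interchange _ _ _ _)

  ∑-*ˡ : ∀ p (f : T → ℤ) xs → ∑ (λ x → p * f x) xs ≡ p * ∑ f xs
  ∑-*ˡ p f []       = sym (*-zeroʳ p)
  ∑-*ˡ p f (x ∷ xs) = trans (cong₂ _+_ refl (∑-*ˡ p f xs)) (sym (*-distribˡ-+ p _ _))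

  ∑-*ʳ : ∀ p (f : T → ℤ) xs → ∑ (λ x → f x * p) xs ≡ ∑ f xs * p
  ∑-*ʳ p f []       = sym (*-zeroˡ p)
  ∑-*ʳ p f (x ∷ xs) = trans (cong₂ _+_ refl (∑-*ʳ p f xs)) (sym (*-distribʳ-+ p _ _))

  ∑-++ : ∀ (f : T → ℤ) xs ys → ∑ f (xs ++ ys) ≡ ∑ f xs + ∑ f ys
  ∑-++ f []       ys = sym (+-identityˡ _)
  ∑-++ f (x ∷ xs) ys = trans (cong₂ _+_ refl (∑-++ f xs ys)) (sym (+-assoc _ _ _))

  ∑-map : ∀ {S} (f : T → ℤ) (h : S → T) xs → ∑ f (map h xs) ≡ ∑ (f ∘ h) xs
  ∑-map f h []       = refl
  ∑-map f h (x ∷ xs) = cong₂ _+_ refl (∑-map f h xs)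

  ∑-cartesianProductWith : ∀ {R S} (f : T → ℤ) (h : R → S → T) xs ys →
    ∑ f (cartesianProductWith h xs ys) ≡ ∑ (λ x → ∑ (λ y → f (h x y)) ys) xs
  ∑-cartesianProductWith f h []       ys = refl
  ∑-cartesianProductWith f h (x ∷ xs) ys =
    trans (∑-++ f (map (h x) ys) _)
          (cong₂ _+_ (∑-map f (h x) ys) (∑-cartesianProductWith f h xs ys))

  ∑-splits : ∀ (f : T → ℤ) B L → ∑ f (splits B L) ≡ split∑ (λ X Y → ∑ f (B X Y)) L
  ∑-splits f B []      = refl
  ∑-splits f B (x ∷ L) = trans (∑-++ f (splits _ L) _)
                               (cong₂ _+_ (∑-splits f _ L) (∑-splits f _ L))

  ⟦_⟧ : Bool → ℤ
  ⟦ b ⟧ = when b 1ℤ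

  ∑-filter : ∀ (f : T → ℤ) (g : T → ℕ) h xs →
             ∑ f (filter (λ x → g x <? h) xs) ≡ ∑ (λ x → f x * ⟦ does (g x <? h) ⟧) xs
  ∑-filter f g h []       = refl
  ∑-filter f g h (x ∷ xs) with does (g x <? h)
  ... | true  = cong₂ _+_ (sym (*-identityʳ _)) (∑-filter f g h xs)
  ... | false = trans (∑-filter f g h xs) (sym (trans (cong₂ _+_ (*-zeroʳ _) refl) (+-identityˡ _)))

  private
    ⟦≟⟧-refl : ∀ x → ⟦ does (x ≟ x) ⟧ ≡ 1ℤ
    ⟦≟⟧-refl x = cong ⟦_⟧ (dec-true (x ≟ x) refl)

    ⟦≟⟧-≢ : ∀ x y → x ≢ y → ⟦ does (x ≟ y) ⟧ ≡ 0ℤ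
    ⟦≟⟧-≢ x y x≢y = cong ⟦_⟧ (dec-false (x ≟ y) x≢y)

  ∑-≟ : ∀ (φ : ℕ → ℤ) {x} L → Decreasing L → x ∈ L → ∑ (λ b → φ b * ⟦ does (x ≟ b) ⟧) L ≡ φ x
  ∑-≟ φ (x ∷ L) (x> ∷ _) (here refl) = trans
    (cong₂ _+_ (trans (cong (φ x *_) (⟦≟⟧-refl x)) (*-identityʳ _))
               (∑-zero L λ {b} b∈L → trans (cong (φ b *_) (⟦≟⟧-≢ x b λ { refl → <-irrefl refl (All.lookup x> b∈L) })) (*-zeroʳ _)))
    (+-identityʳ _)
  ∑-≟ φ {x} (y ∷ L) (y> ∷ d) (there x∈L) = trans
    (cong₂ _+_ (trans (cong (φ y *_) (⟦≟⟧-≢ x y λ { refl → <-irrefl refl (All.lookup y> x∈L) })) (*-zeroʳ _))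
               (∑-≟ φ L d x∈L))
    (+-identityˡ _)

  -- The number of good trees with a given leftmost leaf.

  count : ℕ → List ℕ → ℕ → ℤ
  count k L a = ∑ (λ t → ⟦ does (first t ≟ a) ⟧) (goods k L)

  ∑-by-first : ∀ (φ : ℕ → ℤ) k L → Decreasing L →
               ∑ (φ ∘ first) (goods k L) ≡ ∑ (λ b → φ b * count k L b) L
  ∑-by-first φ k L d = go (goods k L) λ t∈ →
    let good , e , _ = goods-sound k L d t∈ in ∈-resp-↭ e (first∈ good)
    where
    go : ∀ ts → (∀ {t} → t ∈ ts → first t ∈ L) →
         ∑ (φ ∘ first) ts ≡ ∑ (λ b → φ b * ∑ (λ t → ⟦ does (first t ≟ b) ⟧) ts) L
    go []       _  = sym (∑-zero L λ _ → *-zeroʳ _)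
    go (t ∷ ts) ∈L = sym (begin
      ∑ (λ b → φ b * (⟦ does (first t ≟ b) ⟧ + ∑ (λ t → ⟦ does (first t ≟ b) ⟧) ts)) L
        ≡⟨ ∑-cong L (λ _ → *-distribˡ-+ _ _ _) ⟩
      ∑ (λ b → φ b * ⟦ does (first t ≟ b) ⟧ + φ b * ∑ (λ t → ⟦ does (first t ≟ b) ⟧) ts) L
        ≡⟨ ∑-+ _ _ L ⟩
      _ ≡⟨ cong₂ _+_ (∑-≟ φ L d (∈L (here refl))) (sym (go ts (∈L ∘ there))) ⟩
      φ (first t) + ∑ (φ ∘ first) ts ∎)
      where open ≡-Reasoning

  count-∉ : ∀ k {L a} → Decreasing L → a ∉ L → count k L a ≡ 0ℤ
  count-∉ k {L} {a} d a∉L = ∑-zero (goods k L) λ {t} t∈ →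
    let good , e , _ = goods-sound k L d t∈ in
    ⟦≟⟧-≢ (first t) a λ { refl → a∉L (∈-resp-↭ e (first∈ good)) }

  -- The leftmost leaf of a node is that of its left child, and the condition on the right child
  -- sees the left one only through `top X`. Hence the sum over pairs of subtrees factors for each
  -- split.
  count-step : ∀ k m L a → Decreasing L → count (suc k) (m ∷ L) a ≡
    ∑ (λ t → ⟦ does (first t ≟ a) ⟧) (singleton m L) +
    split∑ (λ X Y → count k X a * ∑ (λ b → ⟦ does (b <? top X) ⟧ * count k Y b) Y) L
  count-step k m L a d = trans (∑-++ _ (singleton m L) _) (cong₂ _+_ refl
    (trans (∑-splits _ _ L) (split∑-cong L λ {X} {Y} X⊆ Y⊆ → begin
      ∑ (λ t → ⟦ does (first t ≟ a) ⟧) (cartesianProductWith (λ l r → node l m r) (goods k X) (right X Y))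
        ≡⟨ ∑-cartesianProductWith (λ t → ⟦ does (first t ≟ a) ⟧) (λ l r → node l m r) (goods k X) (right X Y) ⟩
      ∑ (λ l → ∑ (λ r → ⟦ does (first (node l m r) ≟ a) ⟧) (right X Y)) (goods k X)
        ≡⟨ ∑-cong (goods k X) (λ {l} l∈ → begin
             ∑ (λ r → ⟦ does (first (node l m r) ≟ a) ⟧) (right X Y)
               ≡⟨ ∑-filter _ first (top X) (goods k Y) ⟩
             ∑ (λ r → ⟦ does (first (node l m r) ≟ a) ⟧ * ⟦ does (first r <? top X) ⟧) (goods k Y)
               ≡⟨ ∑-cong (goods k Y) (λ {r} _ → cong (λ z → ⟦ does (z ≟ a) ⟧ * ⟦ does (first r <? top X) ⟧)
                    (first-node {m = m} {r} (proj₁ (goods-sound k X (Decreasing-⊆ X⊆ d) l∈)))) ⟩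
             ∑ (λ r → ⟦ does (first l ≟ a) ⟧ * ⟦ does (first r <? top X) ⟧) (goods k Y)
               ≡⟨ ∑-*ˡ _ _ (goods k Y) ⟩
             ⟦ does (first l ≟ a) ⟧ * ∑ (λ r → ⟦ does (first r <? top X) ⟧) (goods k Y) ∎) ⟩
      ∑ (λ l → ⟦ does (first l ≟ a) ⟧ * ∑ (λ r → ⟦ does (first r <? top X) ⟧) (goods k Y)) (goods k X)
        ≡⟨ ∑-*ʳ _ _ (goods k X) ⟩
      count k X a * ∑ (λ r → ⟦ does (first r <? top X) ⟧) (goods k Y)
        ≡⟨ cong (count k X a *_) (∑-by-first (λ b → ⟦ does (b <? top X) ⟧) k Y (Decreasing-⊆ Y⊆ d)) ⟩
      count k X a * ∑ (λ b → ⟦ does (b <? top X) ⟧ * count k Y b) Y ∎)))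
    where
    open ≡-Reasoning
    right : List ℕ → List ℕ → List Tree
    right X Y = filter (λ r → first r <? top X) (goods k Y)

  -- Choosing an entry is integrating over the position of the leaf: in the decreasing lists to
  -- which this is applied, the entries before `b` are those above it.
  ∑-∫₁ : ∀ (F : ℕ → ℤ) (H : List Two → ℤ) L →
         (∀ U b V → L ≡ U ++ b ∷ V → F b ≡ H (tag U V)) → ∑ F L ≡ ∫₁ H (flat L)
  ∑-∫₁ F H []      eq = refl
  ∑-∫₁ F H (b ∷ L) eq = cong₂ _+_
    (trans (eq [] b L refl) (cong H (map-∘ L)))
    (∑-∫₁ F (H ∘ (above ∷_)) L λ U b′ V e → eq (b ∷ U) b′ V (cong (b ∷_) e))

  -- Since `ψ` vanishes on lists without `a`, only the splits with `a` on the left survive; all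
  -- other labels enter through their marks alone.
  ⋆-marked : ∀ U a V {ψ M : List ℕ → ℤ} {f : List Two → ℤ} {g : List ⊤ → ℤ} →
    (∀ {X₁ X₂} → X₁ ⊆ U → X₂ ⊆ V → ψ (X₁ ++ a ∷ X₂) ≡ f (tag X₁ X₂)) →
    (∀ {X} → X ⊆ U ++ V → ψ X ≡ 0ℤ) →
    (∀ {Y} → Y ⊆ U ++ V → M Y ≡ g (flat Y)) →
    (ψ ⋆ M) (U ++ a ∷ V) ≡ (f ⋆ (g ∘ flat)) (tag U V)
  ⋆-marked [] a V {ψ} {M} {f} {g} ψf ψ0 Mg = begin
    ((ψ ∘ (a ∷_)) ⋆ M) V + (ψ ⋆ (M ∘ (a ∷_))) V
      ≡⟨ cong₂ _+_ (⋆-cong⊆ V (ψf []) (λ p → trans (Mg p) (cong g (map-∘ _))))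
                   (split∑-zero V λ p _ → zeroˡ-* (ψ0 p)) ⟩
    ((f ∘ map (const below)) ⋆ (g ∘ flat ∘ map (const below))) V + 0ℤ
      ≡⟨ +-identityʳ _ ⟩
    ((f ∘ map (const below)) ⋆ (g ∘ flat ∘ map (const below))) V
      ≡⟨ ⋆-map (const below) f (g ∘ flat) V ⟩
    (f ⋆ (g ∘ flat)) (map (const below) V) ∎
    where open ≡-Reasoning
  ⋆-marked (u ∷ U) a V {ψ} {M} {f} {g} ψf ψ0 Mg = cong₂ _+_
    (⋆-marked U a V {f = f ∘ (above ∷_)} {g = g} (λ p q → ψf (refl ∷ p) q) (λ p → ψ0 (refl ∷ p)) (λ p → Mg (u ∷ʳ p)))
    (⋆-marked U a V {f = f} {g = g ∘ (tt ∷_)} (λ p q → ψf (u ∷ʳ p) q) (λ p → ψ0 (u ∷ʳ p)) (λ p → Mg (refl ∷ p)))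

  ⟦≮⟧ : ℕ → ℕ → ℤ
  ⟦≮⟧ b h = ⟦ not (does (b <? h)) ⟧

  ⟦<⟧+⟦≮⟧ : ∀ b h → ⟦ does (b <? h) ⟧ + ⟦≮⟧ b h ≡ 1ℤ
  ⟦<⟧+⟦≮⟧ b h with does (b <? h)
  ... | true  = +-identityʳ 1ℤ
  ... | false = +-identityˡ 1ℤ

  private
    ⟦≮⟧-< : ∀ {b h} → b < h → ⟦≮⟧ b h ≡ 0ℤ
    ⟦≮⟧-< {b} {h} b<h = cong (⟦_⟧ ∘ not) (dec-true (b <? h) b<h)

    ⟦≮⟧-> : ∀ {X u} → All (u >_) X → ⟦≮⟧ u (top X) ≡ 1ℤ
    ⟦≮⟧-> {[]}    {u} _         = cong (⟦_⟧ ∘ not) (dec-false (u <? 0) λ ())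
    ⟦≮⟧-> {x ∷ _} {u} (u>x ∷ _) = cong (⟦_⟧ ∘ not) (dec-false (u <? x) (<⇒≯ u>x))

    ∫₂-below : ∀ H (V : List ℕ) → ∫₂ H (map (const below) V) ≡ 0ℤ
    ∫₂-below H []      = refl
    ∫₂-below H (_ ∷ V) = trans (+-identityˡ _) (∫₂-below _ V)

  -- If the largest label `u` goes left, it exceeds every label on the right and nothing is bad. So
  -- `u` goes right, where either it is `b`, and then every left part is bad, or it lies above `b`.
  -- When `a` itself is the largest label, it has to go left and nothing bad remains; hence the
  -- integral starts at a.
  split∑-bad : ∀ U a V {ψ : List ℕ → ℤ} {G : List ℕ → ℕ → ℤ} {f g : List Two → ℤ} →
    Decreasing (U ++ a ∷ V) →
    (∀ {X₁ X₂} → X₁ ⊆ U → X₂ ⊆ V → ψ (X₁ ++ a ∷ X₂) ≡ f (tag X₁ X₂)) →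
    (∀ {X} → X ⊆ U ++ V → ψ X ≡ 0ℤ) →
    (∀ {Y₁ b Y₂} → Y₁ ++ b ∷ Y₂ ⊆ U ++ V → G (Y₁ ++ b ∷ Y₂) b ≡ g (tag Y₁ Y₂)) →
    split∑ (λ X Y → ψ X * ∑ (λ b → ⟦≮⟧ b (top X) * G Y b) Y) (U ++ a ∷ V) ≡
    ∫₂ (lo f ⋆ hi g) (tag U V)
  split∑-bad [] a V {ψ} {G} {f} {g} (a> ∷ _) ψf ψ0 Gg = trans
    (cong₂ _+_
      (split∑-zero V λ {X} {Y} _ q → trans
        (cong (ψ (a ∷ X) *_) (∑-zero Y λ b∈Y →
          zeroˡ-* (⟦≮⟧-< (All.lookup a> (lookup q b∈Y)))))
        (*-zeroʳ _))
      (split∑-zero V λ p _ → zeroˡ-* (ψ0 p)))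
    (trans (+-identityˡ _) (sym (∫₂-below _ V)))
  split∑-bad (u ∷ U) a V {ψ} {G} {f} {g} (u> ∷ d) ψf ψ0 Gg = begin
    split∑ (λ X Y → ψ (u ∷ X) * ∑ (λ b → ⟦≮⟧ b u * G Y b) Y) w +
    split∑ (λ X Y → ψ X * (⟦≮⟧ u (top X) * G (u ∷ Y) u + ∑ (λ b → ⟦≮⟧ b (top X) * G (u ∷ Y) b) Y)) w
      ≡⟨ cong₂ _+_
           (split∑-zero w λ {X} {Y} _ q → trans
             (cong (ψ (u ∷ X) *_) (∑-zero Y λ b∈Y →
               zeroˡ-* (⟦≮⟧-< (All.lookup u> (lookup q b∈Y)))))
             (*-zeroʳ _))
           (trans (split∑-cong w λ {X} {Y} p _ → trans
                    (cong (λ z → ψ X * (z * G (u ∷ Y) u + ∑ (λ b → ⟦≮⟧ b (top X) * G (u ∷ Y) b) Y))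
                          (⟦≮⟧-> (All-resp-⊆ p u>)))
                    (trans (cong (λ z → ψ X * (z + ∑ (λ b → ⟦≮⟧ b (top X) * G (u ∷ Y) b) Y)) (*-identityˡ _))
                           (*-distribˡ-+ _ _ _)))
                  (split∑-+ _ _ w)) ⟩
    0ℤ + ((ψ ⋆ (λ Y → G (u ∷ Y) u)) w +
          split∑ (λ X Y → ψ X * ∑ (λ b → ⟦≮⟧ b (top X) * G (u ∷ Y) b) Y) w)
      ≡⟨ +-identityˡ _ ⟩
    (ψ ⋆ (λ Y → G (u ∷ Y) u)) w +
    split∑ (λ X Y → ψ X * ∑ (λ b → ⟦≮⟧ b (top X) * G (u ∷ Y) b) Y) w
      ≡⟨ cong₂ _+_
           (⋆-marked U a V {f = f} {g = g ∘ map (const below)} (λ p q → ψf (u ∷ʳ p) q) (λ p → ψ0 (u ∷ʳ p))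
             (λ {Y} p → trans (Gg {[]} {u} {Y} (refl ∷ p)) (cong g (map-∘ Y))))
           (split∑-bad U a V {G = λ Y → G (u ∷ Y)} {f = f} {g = g ∘ (above ∷_)} d (λ p q → ψf (u ∷ʳ p) q)
             (λ p → ψ0 (u ∷ʳ p)) (λ {Y₁} p → Gg {u ∷ Y₁} (refl ∷ p))) ⟩
    (f ⋆ (g ∘ map (const below) ∘ flat)) (tag U V) + ∫₂ (lo f ⋆ hi (g ∘ (above ∷_))) (tag U V)
      ≡⟨ cong₂ _+_ (sym (lowered (tag U V))) (∫₂-cong (λ z → sym (raised z)) (tag U V)) ⟩
    (lo f ⋆ hi g) (map lower (tag U V)) + ∫₂ ((lo f ⋆ hi g) ∘ (above ∷_)) (tag U V) ∎
    where
    open ≡-Reasoning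
    w = U ++ a ∷ V
    lowered : ∀ z → (lo f ⋆ hi g) (map lower z) ≡ (f ⋆ (g ∘ map (const below) ∘ flat)) z
    lowered z = trans (sym (⋆-map lower (lo f) (hi g) z))
      (⋆-cong (λ x → trans (cong₂ _*_ (cong δ (tops-lower x)) (cong f (topless-lower x))) (*-identityˡ _))
              (λ x → cong g (merge-lower x)) z)
      where
      tops-lower : ∀ x → tops (map lower x) ≡ []
      tops-lower []          = refl
      tops-lower (above ∷ x) = tops-lower x
      tops-lower (below ∷ x) = tops-lower x
      topless-lower : ∀ x → topless (map lower x) ≡ x
      topless-lower []          = refl
      topless-lower (above ∷ x) = cong (above ∷_) (topless-lower x)
      topless-lower (below ∷ x) = cong (below ∷_) (topless-lower x)
      merge-lower : ∀ x → map merge (map lower x) ≡ map (const below) (flat x)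
      merge-lower []          = refl
      merge-lower (above ∷ x) = cong (below ∷_) (merge-lower x)
      merge-lower (below ∷ x) = cong (below ∷_) (merge-lower x)
    raised : ∀ z → (lo f ⋆ hi g) (above ∷ z) ≡ (lo f ⋆ hi (g ∘ (above ∷_))) z
    raised z = trans
      (cong₂ _+_ (split∑-zero z λ _ _ → zeroˡ-* (*-zeroˡ _)) refl)
      (+-identityˡ _)

  Decreasing⇒∉ : ∀ U {a V} → Decreasing (U ++ a ∷ V) → a ∉ U ++ V
  Decreasing⇒∉ []      (a> ∷ _) a∈ = <-irrefl refl (All.lookup a> a∈)
  Decreasing⇒∉ (u ∷ U) (u> ∷ _) (here refl) = <-irrefl refl (All.lookup u> (∈-++⁺ʳ U (here refl)))
  Decreasing⇒∉ (u ∷ U) (_ ∷ d) (there a∈) = Decreasing⇒∉ U d a∈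

  -- The clauses treat a single label, the impossible case of `a` being the largest of several
  -- labels, and a root above `a`. The first two are the initial condition, the last is the
  -- differential equation.
  count-tag : ∀ k U a V → length (U ++ a ∷ V) ≤ k → Decreasing (U ++ a ∷ V) →
              count k (U ++ a ∷ V) a ≡ γ (tag U V)
  count-tag (suc k) [] a [] _ _ = begin
    ⟦ does (a ≟ a) ⟧ + 0ℤ ≡⟨ +-identityʳ _ ⟩
    ⟦ does (a ≟ a) ⟧      ≡⟨ ⟦≟⟧-refl a ⟩
    1ℤ                    ≡⟨ γ-below {X = ℕ} [] ⟨
    γ []                  ∎
    where open ≡-Reasoning
  count-tag (suc k) [] a V@(_ ∷ _) _ (a> ∷ d) = begin
    count (suc k) (a ∷ V) a
      ≡⟨ count-step k a V a d ⟩
    0ℤ + split∑ (λ X Y → count k X a * ∑ (λ b → ⟦ does (b <? top X) ⟧ * count k Y b) Y) V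
      ≡⟨ +-identityˡ _ ⟩
    split∑ (λ X Y → count k X a * ∑ (λ b → ⟦ does (b <? top X) ⟧ * count k Y b) Y) V
      ≡⟨ split∑-zero V (λ {X} {Y} p _ → zeroˡ-* {q = ∑ (λ b → ⟦ does (b <? top X) ⟧ * count k Y b) Y}
           (count-∉ k (Decreasing-⊆ p d) λ a∈ → <-irrefl refl (All.lookup a> (lookup p a∈)))) ⟩
    0ℤ
      ≡⟨ γ-below V ⟨
    γ (map (const below) V) ∎
    where open ≡-Reasoning
  count-tag (suc k) (m ∷ U) a V (s≤s len) (_ ∷ d) = begin
    count (suc k) (m ∷ L) a
      ≡⟨ count-step k m L a d ⟩
    ∑ (λ t → ⟦ does (first t ≟ a) ⟧) (singleton m L) + split∑ allowed L
      ≡⟨ cong₂ _+_ (cong (∑ _) (nonempty U)) refl ⟩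
    0ℤ + split∑ allowed L
      ≡⟨ +-identityˡ _ ⟩
    split∑ allowed L
      -- Without the condition linking the subtrees, the sum over splits is a plain product; the
      -- violating pairs are then subtracted.
      ≡⟨ +-minus _ _ _ (trans (split∑-cong L λ {X} {Y} _ _ → split-pairs X Y) (split∑-+ allowed bad L)) ⟩
    (ψ ⋆ M) L - split∑ bad L
      ≡⟨ cong₂ _-_ (⋆-marked U a V {f = γ} {g = ρ} ψ-γ ψ-0 M-ρ) (split∑-bad U a V {f = γ} {g = γ} d ψ-γ ψ-0 G-γ) ⟩
    (γ ⋆ (ρ ∘ flat)) (tag U V) - ∫₂ (lo γ ⋆ hi γ) (tag U V)
      ≡⟨ γ-above (tag U V) ⟨
    γ (above ∷ tag U V) ∎
    where
    open ≡-Reasoning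
    L = U ++ a ∷ V
    ψ M : List ℕ → ℤ
    ψ X = count k X a
    M Y = ∑ (λ b → count k Y b) Y
    allowed bad : List ℕ → List ℕ → ℤ
    allowed X Y = ψ X * ∑ (λ b → ⟦ does (b <? top X) ⟧ * count k Y b) Y
    bad X Y     = ψ X * ∑ (λ b → ⟦≮⟧ b (top X) * count k Y b) Y

    nonempty : ∀ U {V} → singleton m (U ++ a ∷ V) ≡ []
    nonempty []      = refl
    nonempty (_ ∷ _) = refl

    split-pairs : ∀ X Y → ψ X * M Y ≡ allowed X Y + bad X Y
    split-pairs X Y = begin
      ψ X * ∑ (λ b → count k Y b) Y
        ≡⟨ cong (ψ X *_) (∑-cong Y λ {b} _ → begin
             count k Y b                                            ≡⟨ *-identityˡ _ ⟨
             1ℤ * count k Y b                                       ≡⟨ cong (_* _) (⟦<⟧+⟦≮⟧ b (top X)) ⟨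
             (⟦ does (b <? top X) ⟧ + ⟦≮⟧ b (top X)) * count k Y b  ≡⟨ *-distribʳ-+ _ _ _ ⟩
             ⟦ does (b <? top X) ⟧ * count k Y b + ⟦≮⟧ b (top X) * count k Y b ∎) ⟩
      ψ X * ∑ (λ b → ⟦ does (b <? top X) ⟧ * count k Y b + ⟦≮⟧ b (top X) * count k Y b) Y
        ≡⟨ cong (ψ X *_) (∑-+ _ _ Y) ⟩
      _ ≡⟨ *-distribˡ-+ _ _ _ ⟩
      allowed X Y + bad X Y ∎

    sublist : ∀ {W} → W ⊆ U ++ V → W ⊆ L
    sublist p = ⊆-trans p (⊆-++⁺ (⊆-refl {x = U}) (a ∷ʳ ⊆-refl))

    known : ∀ {U b V} → U ++ b ∷ V ⊆ L → count k (U ++ b ∷ V) b ≡ γ (tag U V)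
    known {U} {b} {V} p = count-tag k U b V (≤-trans (length-mono-≤ p) len) (Decreasing-⊆ p d)

    ψ-γ : ∀ {X₁ X₂} → X₁ ⊆ U → X₂ ⊆ V → ψ (X₁ ++ a ∷ X₂) ≡ γ (tag X₁ X₂)
    ψ-γ {X₁} p q = known {X₁} (⊆-++⁺ p (refl ∷ q))

    ψ-0 : ∀ {X} → X ⊆ U ++ V → ψ X ≡ 0ℤ
    ψ-0 p = count-∉ k (Decreasing-⊆ (sublist p) d) (Decreasing⇒∉ U d ∘ lookup p)

    M-ρ : ∀ {Y} → Y ⊆ U ++ V → M Y ≡ ρ (flat Y)
    M-ρ {Y} p = ∑-∫₁ (λ b → count k Y b) γ Y λ { U′ b V′ refl → known {U′} (sublist p) }

    G-γ : ∀ {Y₁ b Y₂} → Y₁ ++ b ∷ Y₂ ⊆ U ++ V → count k (Y₁ ++ b ∷ Y₂) b ≡ γ (tag Y₁ Y₂)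
    G-γ {Y₁} p = known {Y₁} (sublist p)

-- Stack sorting as the passage from inorder to postorder.

module StackSorting where
  open Enumeration
  open import Data.Nat.Base using (_+_; _*_; _<ᵇ_)
  open import Data.Nat.Properties
    using (+-comm; +-suc; +-identityʳ; +-mono-≤; +-monoˡ-≤; +-monoʳ-≤; +-cancelˡ-≤; +-cancelʳ-≤;
           *-comm; *-monoʳ-≤; m≤m+n; m≢1+m+n)
  open import Data.Nat.Tactic.RingSolver using (solve-∀)

  private variable
    T : Set

  postorder : Tree → List ℕ
  postorder nil          = []
  postorder (node l m r) = postorder l ++ postorder r ++ [ m ]

  data Heap : Tree → Set where
    nil  : Heap nil
    node : ∀ {l m r} → Heap l → Heap r → All (_< m) (inorder l) → All (_< m) (inorder r) →
           Heap (node l m r)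

  postorder↭inorder : ∀ t → postorder t ↭ inorder t
  postorder↭inorder nil          = refl
  postorder↭inorder (node l m r) = ↭-++⁺ (postorder↭inorder l)
    (↭-trans (shift m (postorder r) []) (prep m (↭-trans (↭-reflexive (++-identityʳ _)) (postorder↭inorder r))))

  -- An entry larger than everything before it empties the stack before it is pushed.
  stackSort-max : ∀ st α {m β} → All (_< m) st → All (_< m) α →
                  stackSort st (α ++ m ∷ β) ≡ stackSort st α ++ stackSort [ m ] β
  stackSort-max []       []      _           _           = refl
  stackSort-max (t ∷ st) []      {m} (t<m ∷ st<) _
    rewrite dec-false (m <? t) (<⇒≯ t<m) = cong (t ∷_) (stackSort-max st [] st< [])
  stackSort-max []       (x ∷ α) _           (x<m ∷ α<)  = stackSort-max [ x ] α (x<m ∷ []) α<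
  stackSort-max (t ∷ st) (x ∷ α) (t<m ∷ st<) (x<m ∷ α<)
    with x <ᵇ t | stackSort-max (x ∷ t ∷ st) α (x<m ∷ t<m ∷ st<) α< | stackSort-max st (x ∷ α) st< (x<m ∷ α<)
  ... | true  | pushed | _      = pushed
  ... | false | _      | popped = cong (t ∷_) popped

  -- A bottom entry larger than all that follows is never popped before the input ends, and it lets
  -- every later entry in just as an empty stack would.
  stackSort-bottom : ∀ st β {m} → All (_< m) st → All (_< m) β →
                     stackSort (st ++ [ m ]) β ≡ stackSort st β ++ [ m ]
  stackSort-bottom []       []      _           _          = refl
  stackSort-bottom (t ∷ st) []      (_ ∷ st<)   _          = cong (t ∷_) (stackSort-bottom st [] st< [])
  stackSort-bottom []       (x ∷ β) {m} _       (x<m ∷ β<)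
    rewrite dec-true (x <? m) x<m = stackSort-bottom [ x ] β (x<m ∷ []) β<
  stackSort-bottom (t ∷ st) (x ∷ β) (t<m ∷ st<) (x<m ∷ β<)
    with x <ᵇ t | stackSort-bottom (x ∷ t ∷ st) β (x<m ∷ t<m ∷ st<) β< | stackSort-bottom st (x ∷ β) st< (x<m ∷ β<)
  ... | true  | pushed | _      = pushed
  ... | false | _      | popped = cong (t ∷_) popped

  s-inorder : ∀ {t} → Heap t → s (inorder t) ≡ postorder t
  s-inorder nil = refl
  s-inorder (node {l} {m} {r} hl hr l< r<) = begin
    s (inorder l ++ m ∷ inorder r)          ≡⟨ stackSort-max [] (inorder l) [] l< ⟩
    s (inorder l) ++ stackSort [ m ] (inorder r)
      ≡⟨ cong (s (inorder l) ++_) (stackSort-bottom [] (inorder r) [] r<) ⟩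
    s (inorder l) ++ s (inorder r) ++ [ m ]
      ≡⟨ cong₂ (λ u w → u ++ w ++ [ m ]) (s-inorder hl) (s-inorder hr) ⟩
    postorder l ++ postorder r ++ [ m ] ∎
    where open ≡-Reasoning

  Heap-≤root : ∀ {t} → Heap t → All (_≤ root t) (inorder t)
  Heap-≤root nil                = []
  Heap-≤root (node _ _ l< r<) = All-++⁺ (All.map <⇒≤ l<) (≤-refl ∷ All.map <⇒≤ r<)

  -- The new first letter descends the left spine to the first smaller label, whose subtree becomes
  -- its right child.
  insert : ∀ x {t} → Heap t → All (x ≢_) (inorder t) → ∃ λ t′ → Heap t′ × inorder t′ ≡ x ∷ inorder t
  insert x nil _ = node nil x nil , node nil nil [] [] , refl
  insert x {t} h@(node {l} {m} {r} hl hr l< r<) x∉ with <-cmp x m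
  ... | tri≈ _ refl _ = ⊥-elim (All.lookup x∉ (∈-++⁺ʳ (inorder l) (here refl)) refl)
  ... | tri> _ _ m<x  = node nil x t , node nil h [] (All.map (λ p → ≤-<-trans p m<x) (Heap-≤root h)) , refl
  ... | tri< x<m _ _ with insert x hl (All-++⁻ˡ (inorder l) x∉)
  ...   | l′ , hl′ , eq = node l′ m r , node hl′ hr (subst (All (_< m)) (sym eq) (x<m ∷ l<)) r< ,
                          cong (_++ m ∷ inorder r) eq

  heap-of : ∀ {w} → Unique w → ∃ λ t → Heap t × inorder t ≡ w
  heap-of []       = nil , nil , refl
  heap-of (x∉ ∷ u) with heap-of u
  ... | t , h , refl = insert _ h x∉

  Good⇒Heap : ∀ {t} → Good t → Heap t
  Good⇒Heap leaf = node nil nil [] []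
  Good⇒Heap (node gl gr _ l< r<) = node (Good⇒Heap gl) (Good⇒Heap gr)
    (All.map (λ p → ≤-<-trans p l<) (Heap-≤root (Good⇒Heap gl)))
    (All.map (λ p → ≤-<-trans p r<) (Heap-≤root (Good⇒Heap gr)))

  postorder-first : ∀ {t} → Good t → ∃ λ w → postorder t ≡ first t ∷ w
  postorder-first leaf = [] , refl
  postorder-first (node {l} {m} {r} gl gr _ _ _) with postorder-first gl
  ... | w , eq = w ++ postorder r ++ [ m ] ,
    trans (cong (_++ postorder r ++ [ m ]) eq) (cong (_∷ _) (sym (first-node gl)))

  postorder-root : ∀ l m r → postorder (node l m r) ≡ (postorder l ++ postorder r) ++ [ m ]
  postorder-root l m r = sym (++-assoc (postorder l) _ _)

  -- Descents of sorted words, and reconstruction of good trees.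

  descent : ℕ → ℕ → ℕ
  descent x y = if y <ᵇ x then 1 else 0

  descents : List ℕ → ℕ
  descents []          = 0
  descents (x ∷ [])    = 0
  descents (x ∷ y ∷ w) = descent x y + descents (y ∷ w)

  descents-++ : ∀ u x y v → descents ((u ++ [ x ]) ++ y ∷ v) ≡ descents (u ++ [ x ]) + descent x y + descents (y ∷ v)
  descents-++ []          x y v = refl
  descents-++ (a ∷ [])    x y v = assoc (descent a x) _ _
    where
    assoc : ∀ p q r → p + (q + r) ≡ p + 0 + q + r
    assoc = solve-∀
  descents-++ (a ∷ b ∷ u) x y v = trans (cong (descent a b +_) (descents-++ (b ∷ u) x y v)) (assoc (descent a b) _ _ _)
    where
    assoc : ∀ p q r t → p + (q + r + t) ≡ p + q + r + t
    assoc = solve-∀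

  descents-max : ∀ w {m} → All (_< m) w → descents (w ++ [ m ]) ≡ descents w
  descents-max []          _ = refl
  descents-max (x ∷ [])    {m} (x<m ∷ _) rewrite dec-false (m <? x) (<⇒≯ x<m) = refl
  descents-max (x ∷ y ∷ w) (_ ∷ p) = cong (descent x y +_) (descents-max (y ∷ w) p)

  descent≤1 : ∀ x y → descent x y ≤ 1
  descent≤1 x y with y <ᵇ x
  ... | true  = ≤-refl
  ... | false = z≤n

  descent-> : ∀ {x y} → y < x → descent x y ≡ 1
  descent-> {x} {y} y<x rewrite dec-true (y <? x) y<x = refl

  postorder< : ∀ {m} t → All (_< m) (inorder t) → All (_< m) (postorder t)
  postorder< t = All-resp-↭ (↭-sym (postorder↭inorder t))

  descents-glue : ∀ l m r {y v} → descents (postorder (node l m r) ++ y ∷ v) ≡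
                  descents (postorder (node l m r)) + descent m y + descents (y ∷ v)
  descents-glue l m r {y} {v} rewrite postorder-root l m r = descents-++ (postorder l ++ postorder r) m y v

  descents-node : ∀ {l m r} → Heap (node l m r) → descents (postorder (node l m r)) ≡ descents (postorder l ++ postorder r)
  descents-node {l} {m} {r} (node _ _ l< r<) = trans (cong descents (postorder-root l m r))
    (descents-max (postorder l ++ postorder r) (All-++⁺ (postorder< l l<) (postorder< r r<)))

  size : Tree → ℕ
  size t = length (postorder t)

  size-node : ∀ l m r → size (node l m r) ≡ suc (size l + size r)
  size-node l m r = trans (length-++ (postorder l)) (trans (cong (size l +_) (length-++ (postorder r))) (comm (size l) (size r)))
    where
    comm : ∀ p q → p + (q + 1) ≡ suc (p + q)
    comm = solve-∀

  des : Tree → ℕ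
  des t = descents (postorder t)

  postorder-nonempty : ∀ l m r → ∃₂ λ y v → postorder (node l m r) ≡ y ∷ v
  postorder-nonempty l m r with postorder l | postorder r
  ... | []    | []    = m , [] , refl
  ... | []    | y ∷ v = y , v ++ [ m ] , refl
  ... | y ∷ v | w     = y , v ++ w ++ [ m ] , refl

  des-node : ∀ {l₁ x l₂ m r y v} → Heap (node (node l₁ x l₂) m r) → postorder r ≡ y ∷ v →
             des (node (node l₁ x l₂) m r) ≡ des (node l₁ x l₂) + descent x y + des r
  des-node {l₁} {x} {l₂} {m} {r} {y} {v} h eq = trans (descents-node h) (trans
    (cong (λ w → descents (postorder (node l₁ x l₂) ++ w)) eq)
    (trans (descents-glue l₁ x l₂) (cong (λ w → des (node l₁ x l₂) + descent x y + descents w) (sym eq))))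

  -- A node with two children adds at most one descent, at the junction of the two postorder words.
  -- A node with one child adds a label but no descent.
  two-des<size : ∀ {l m r} → Heap (node l m r) → 1 + 2 * des (node l m r) ≤ size (node l m r)
  two-des<size {nil} {m} {nil} _ = ≤-refl
  two-des<size {nil} {m} {r@(node _ _ _)} h@(node _ hr _ _)
    rewrite descents-node h | size-node nil m r = ≤-trans (two-des<size hr) (n≤1+n _)
  two-des<size {l@(node _ _ _)} {m} {nil} h@(node hl _ _ _)
    rewrite descents-node h | ++-identityʳ (postorder l) | size-node l m nil | +-identityʳ (size l) =
    ≤-trans (two-des<size hl) (n≤1+n _)
  two-des<size {l@(node l₁ x l₂)} {m} {r@(node r₁ z r₂)} h@(node hl hr _ _) with postorder-nonempty r₁ z r₂
  ... | y , v , eq rewrite des-node h eq | size-node l m r = begin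
    1 + 2 * (des l + descent x y + des r) ≤⟨ +-monoʳ-≤ 1 (*-monoʳ-≤ 2 (+-monoˡ-≤ (des r) (+-monoʳ-≤ (des l) (descent≤1 x y)))) ⟩
    1 + 2 * (des l + 1 + des r)           ≡⟨ rearrange (des l) (des r) ⟩
    suc ((1 + 2 * des l) + (1 + 2 * des r)) ≤⟨ s≤s (+-mono-≤ (two-des<size hl) (two-des<size hr)) ⟩
    suc (size l + size r)                 ∎
    where
    open ≤-Reasoning
    rearrange : ∀ p q → 1 + 2 * (p + 1 + q) ≡ suc ((1 + 2 * p) + (1 + 2 * q))
    rearrange = solve-∀

  Good⇒size : ∀ {t} → Good t → size t ≡ 1 + 2 * des t
  Good⇒size leaf = refl
  Good⇒size g@(node {l@(node _ x _)} {m} {r} gl gr f< _ _) with postorder-first gr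
  ... | v , eq rewrite des-node (Good⇒Heap g) eq | size-node l m r | descent-> f< | Good⇒size gl | Good⇒size gr =
    rearrange (des l) (des r)
    where
    rearrange : ∀ p q → suc ((1 + 2 * p) + (1 + 2 * q)) ≡ 1 + 2 * (p + 1 + q)
    rearrange = solve-∀

  -- Equality in `two-des<size` rules out single children, forces a descent at each junction and
  -- passes to both subtrees. The letter after the junction is `first r` as soon as `r` is known to
  -- be good.
  size⇒Good : ∀ {l m r} → Heap (node l m r) → size (node l m r) ≤ 1 + 2 * des (node l m r) → Good (node l m r)
  size⇒Good {nil} {m} {nil} h p = leaf
  size⇒Good {nil} {m} {r@(node _ _ _)} h@(node _ hr _ _) p
    rewrite descents-node h | size-node nil m r = ⊥-elim (<-irrefl refl (≤-trans p (two-des<size hr)))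
  size⇒Good {l@(node _ _ _)} {m} {nil} h@(node hl _ _ _) p
    rewrite descents-node h | ++-identityʳ (postorder l) | size-node l m nil | +-identityʳ (size l) =
    ⊥-elim (<-irrefl refl (≤-trans p (two-des<size hl)))
  size⇒Good {l@(node l₁ x l₂)} {m} {r@(node r₁ z r₂)} h@(node hl hr l< r<) p with postorder-nonempty r₁ z r₂
  ... | y , v , eq rewrite des-node h eq | size-node l m r with y <? x
  ...   | no y≮x rewrite dec-false (y <? x) y≮x = ⊥-elim (<-irrefl refl (begin-strict
    1 + (des l + 0 + des r) * 2          ≡⟨ rearrange (des l) (des r) ⟩
    2 * des l + (1 + 2 * des r)          <⟨ +-mono-≤ (two-des<size hl) (two-des<size hr) ⟩
    size l + size r                      ≤⟨ n≤1+n _ ⟩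
    suc (size l + size r)                ≤⟨ p ⟩
    1 + 2 * (des l + 0 + des r)          ≡⟨ cong suc (*-comm 2 (des l + 0 + des r)) ⟩
    1 + (des l + 0 + des r) * 2          ∎))
    where
    open ≤-Reasoning
    rearrange : ∀ p q → 1 + (p + 0 + q) * 2 ≡ 2 * p + (1 + 2 * q)
    rearrange = solve-∀
  ...   | yes y<x = node gl gr (subst (_< x) y≡first y<x)
            (All.lookup l< (root∈ gl)) (All.lookup r< (root∈ gr))
    where
    total : size l + size r ≤ (1 + 2 * des l) + (1 + 2 * des r)
    total = ≤-pred (begin
      suc (size l + size r)                   ≤⟨ p ⟩
      1 + 2 * (des l + descent x y + des r)   ≡⟨ cong (λ d → 1 + 2 * (des l + d + des r)) (descent-> y<x) ⟩
      1 + 2 * (des l + 1 + des r)             ≡⟨ rearrange (des l) (des r) ⟩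
      suc ((1 + 2 * des l) + (1 + 2 * des r)) ∎)
      where
      open ≤-Reasoning
      rearrange : ∀ p q → 1 + 2 * (p + 1 + q) ≡ suc ((1 + 2 * p) + (1 + 2 * q))
      rearrange = solve-∀
    gl : Good l
    gl = size⇒Good hl (+-cancelʳ-≤ (size r) _ _ (≤-trans total (+-monoʳ-≤ (1 + 2 * des l) (two-des<size hr))))
    gr : Good r
    gr = size⇒Good hr (+-cancelˡ-≤ (size l) _ _ (≤-trans total (+-monoˡ-≤ (1 + 2 * des r) (two-des<size hl))))
    y≡first : y ≡ first r
    y≡first = proj₁ (∷-injective (trans (sym eq) (proj₂ (postorder-first gr))))

  ++-compare : ∀ (u v : List T) {x y} → u ++ x ≡ v ++ y →
               (∃ λ w → v ≡ u ++ w × x ≡ w ++ y) ⊎ (∃₂ λ a w → u ≡ v ++ a ∷ w × y ≡ a ∷ w ++ x)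
  ++-compare []      v       eq = inj₁ (v , refl , eq)
  ++-compare (a ∷ u) []      eq = inj₂ (a , u , refl , sym eq)
  ++-compare (a ∷ u) (b ∷ v) eq with ∷-injective eq
  ... | refl , eq′ with ++-compare u v eq′
  ...   | inj₁ (w , refl , e)     = inj₁ (w , refl , e)
  ...   | inj₂ (c , w , refl , e) = inj₂ (c , w , refl , e)

  -- Every prefix is a forest of good trees whose consecutive members T, T′ satisfy
  -- root T > first T′, so it has many descents.
  length≤-descents-prefix : ∀ {t} → Good t → ∀ {y C D} → postorder t ≡ (y ∷ C) ++ D →
                            length (y ∷ C) ≤ 1 + 2 * descents (y ∷ C)
  length≤-descents-prefix leaf {C = []}    eq = ≤-refl
  length≤-descents-prefix leaf {C = _ ∷ _} ()
  length≤-descents-prefix g@(node {l@(node l₁ x l₂)} {m} {r} gl gr f< _ _) {y} {C} {D} eq = left (++-compare (postorder l) (y ∷ C) eq)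
    where
    extend : ∀ {z w D} → postorder r ≡ (z ∷ w) ++ D →
             length (postorder l ++ z ∷ w) ≤ 1 + 2 * descents (postorder l ++ z ∷ w)
    extend {z} {w} {D} e with proj₁ (∷-injective (trans (sym e) (proj₂ (postorder-first gr))))
    ... | refl
      rewrite length-++ (postorder l) {z ∷ w} | descents-glue l₁ x l₂ {z} {w} | descent-> f< | Good⇒size gl = begin
      1 + 2 * des l + length (z ∷ w)                   ≤⟨ +-monoʳ-≤ (1 + 2 * des l) (length≤-descents-prefix gr {C = w} e) ⟩
      1 + 2 * des l + (1 + 2 * descents (z ∷ w))       ≤⟨ n≤1+n _ ⟩
      suc (1 + 2 * des l + (1 + 2 * descents (z ∷ w))) ≡⟨ rearrange (des l) (descents (z ∷ w)) ⟩
      1 + 2 * (des l + 1 + descents (z ∷ w))           ∎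
      where
      open ≤-Reasoning
      rearrange : ∀ p q → suc (1 + 2 * p + (1 + 2 * q)) ≡ 1 + 2 * (p + 1 + q)
      rearrange = solve-∀

    right : ∀ w → y ∷ C ≡ postorder l ++ w → postorder r ++ [ m ] ≡ w ++ D →
            length (y ∷ C) ≤ 1 + 2 * descents (y ∷ C)
    right []      e _ = length≤-descents-prefix gl {C = C} {D = []}
      (trans (sym (++-identityʳ _)) (trans (sym e) (sym (++-identityʳ _))))
    right (z ∷ w) e e′ with ++-compare (postorder r) (z ∷ w) e′
    ... | inj₂ (_ , _ , e″ , _) = subst (λ u → length u ≤ 1 + 2 * descents u) (sym e) (extend e″)
    ... | inj₁ ([] , e″ , _) = subst (λ u → length u ≤ 1 + 2 * descents u) (sym e)
            (extend (trans (sym (++-identityʳ _)) (trans (sym e″) (sym (++-identityʳ _)))))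
    ... | inj₁ (_ ∷ [] , e″ , e‴) = subst (λ u → length u ≤ 1 + 2 * descents u)
            (sym (trans e (cong (postorder l ++_) (trans e″ (cong (λ v → postorder r ++ [ v ]) (sym (proj₁ (∷-injective e‴))))))))
            (≤-reflexive (Good⇒size g))
    ... | inj₁ (_ ∷ _ ∷ _ , _ , ())

    left : _ → _
    left (inj₂ (_ , _ , e , _)) = length≤-descents-prefix gl {C = C} e
    left (inj₁ (w , e , e′))    = right w e e′

  -- The parity count behind uniqueness: A = postorder l, A E = postorder l′ and
  -- E a prefix of postorder r.
  no-longer-split : ∀ {l r l′ y E D} → Good l → Good r → first r < root l → Good l′ →
                    postorder l′ ≡ postorder l ++ y ∷ E → postorder r ≡ (y ∷ E) ++ D → ⊥
  no-longer-split {l@(node l₁ x l₂)} {r} {l′@(node _ _ _)} {y} {E} gl gr f< gl′ el er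
    with proj₁ (∷-injective (trans (sym er) (proj₂ (postorder-first gr))))
  ... | refl = <-irrefl refl (begin-strict
    1 + (2 * des l + (1 + 2 * descents (y ∷ E))) <⟨ n<1+n _ ⟩
    2 + (2 * des l + (1 + 2 * descents (y ∷ E))) ≡⟨ rearrange (des l) (descents (y ∷ E)) ⟩
    1 + 2 * (des l + 1 + descents (y ∷ E))     ≡⟨ cong (λ d → 1 + 2 * d) des-l′ ⟨
    1 + 2 * des l′                             ≡⟨ Good⇒size gl′ ⟨
    size l′                                    ≡⟨ trans (cong length el) (length-++ (postorder l)) ⟩
    size l + length (y ∷ E)                    ≤⟨ +-mono-≤ (≤-reflexive (Good⇒size gl)) (length≤-descents-prefix gr {C = E} er) ⟩
    1 + 2 * des l + (1 + 2 * descents (y ∷ E)) ≡⟨⟩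
    1 + (2 * des l + (1 + 2 * descents (y ∷ E))) ∎)
    where
    open ≤-Reasoning
    rearrange : ∀ p q → 2 + (2 * p + (1 + 2 * q)) ≡ 1 + 2 * (p + 1 + q)
    rearrange = solve-∀
    des-l′ : des l′ ≡ des l + 1 + descents (y ∷ E)
    des-l′ = trans (cong descents el) (trans (descents-glue l₁ x l₂)
      (cong (λ d → des l + d + descents (y ∷ E)) (descent-> f<)))

  postorder-leaf≢node : ∀ {k l m r} → Good l → [ k ] ≢ postorder (node l m r)
  postorder-leaf≢node {l = l} {m} {r} gl eq with postorder-first gl
  ... | w , e with trans eq (cong (_++ postorder r ++ [ m ]) e)
  ...   | eq′ with ++-conicalʳ (w ++ postorder r) [ m ] (trans (++-assoc w _ _) (sym (proj₂ (∷-injective eq′))))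
  ...     | ()

  -- The last letter is the root. If the two trees cut the remaining word at different places,
  -- `no-longer-split` applies to the one with the longer left part.
  postorder-injective : ∀ {t t′} → Good t → Good t′ → postorder t ≡ postorder t′ → t ≡ t′
  postorder-injective leaf leaf refl = refl
  postorder-injective leaf (node {r = r} g _ _ _ _) eq = ⊥-elim (postorder-leaf≢node {r = r} g eq)
  postorder-injective (node {r = r} g _ _ _ _) leaf eq = ⊥-elim (postorder-leaf≢node {r = r} g (sym eq))
  postorder-injective (node {l} {m} {r} gl gr f< _ _) (node {l′} {m′} {r′} gl′ gr′ f<′ _ _) eq
    with ∷ʳ-injective (postorder l ++ postorder r) (postorder l′ ++ postorder r′)
           (trans (sym (postorder-root l m r)) (trans eq (postorder-root l′ m′ r′)))
  ... | e , refl with ++-compare (postorder l) (postorder l′) e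
  ...   | inj₁ ([] , el , er) =
    cong₂ (λ l r → node l m r) (postorder-injective gl gl′ (trans (sym (++-identityʳ _)) (sym el)))
                               (postorder-injective gr gr′ er)
  ...   | inj₁ (_ ∷ _ , el , er) = ⊥-elim (no-longer-split gl gr f< gl′ el er)
  ...   | inj₂ (_ , _ , el , er) = ⊥-elim (no-longer-split gl′ gr′ f<′ gl el er)

  -- If all labels of l are below the first label of r, then s(l) s(r) is sorted
  -- as well: hang l below the leftmost leaf of r.
  graft : ∀ {l r} → Heap l → Good r → All (_< first r) (inorder l) →
          ∃ λ t → Heap t × inorder t ↭ inorder l ++ inorder r × postorder t ≡ postorder l ++ postorder r
  graft {l} hl (leaf {m}) l< = node l m nil , node hl nil l< [] , refl , refl
  graft {l} hl (node {r₁} {m} {r₂} g₁ g₂ f< m> m>′) l<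
    with graft hl g₁ (subst (λ f → All (_< f) (inorder l)) (first-node g₁) l<)
  ... | t , ht , i , p = node t m r₂ ,
    node ht h₂ (All-resp-↭ (↭-sym i) (All-++⁺ (All.map (λ q → <-trans q f<m) l<) r₁<)) r₂< ,
    ↭-trans (↭-++⁺ʳ (m ∷ inorder r₂) i) (↭-reflexive (++-assoc (inorder l) _ _)) ,
    trans (cong (_++ postorder r₂ ++ [ m ]) p) (++-assoc (postorder l) _ _)
    where
    r₁< : All (_< m) (inorder r₁)
    r₁< with Good⇒Heap (node g₁ g₂ f< m> m>′)
    ... | node _ _ q _ = q
    r₂< : All (_< m) (inorder r₂)
    r₂< with Good⇒Heap (node g₁ g₂ f< m> m>′)
    ... | node _ _ _ q = q
    h₂ : Heap r₂
    h₂ = Good⇒Heap g₂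
    f<m : first (node r₁ m r₂) < m
    f<m = subst (_< m) (sym (first-node g₁)) (All.lookup r₁< (first∈ g₁))

  -- Good trees as the trees determined by their sorted words.

  Unique-disjoint : ∀ v {w} {z : ℕ} → Unique (v ++ w) → z ∈ v → z ∉ w
  Unique-disjoint (_ ∷ v) (p ∷ _) (here refl) z∈w = All.lookup p (∈-++⁺ʳ v z∈w) refl
  Unique-disjoint (_ ∷ v) (_ ∷ u) (there z∈v) z∈w = Unique-disjoint v u z∈v z∈w

  OnlyPreimage : Tree → Set
  OnlyPreimage t = ∀ t′ → Heap t′ → inorder t′ ↭ inorder t → postorder t′ ≡ postorder t → t′ ≡ t

  -- Each failure yields a second tree with the same postorder word: an only child moves to the
  -- other side, and a left subtree whose root is below `first r` is hung inside `r` by `graft`.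
  -- Subtrees inherit the property because a replacement in a subtree is a replacement in the whole
  -- tree.
  OnlyPreimage⇒Good : ∀ {l m r} → Heap (node l m r) → Unique (inorder (node l m r)) →
                      OnlyPreimage (node l m r) → Good (node l m r)
  OnlyPreimage⇒Good {nil} {m} {nil} _ _ _ = leaf
  OnlyPreimage⇒Good {nil} {m} {r@(node _ _ _)} (node hl hr l< r<) _ only
    with only (node r m nil) (node hr hl r< l<)
           (↭-trans (shift m (inorder r) []) (prep m (↭-reflexive (++-identityʳ _)))) refl
  ... | ()
  OnlyPreimage⇒Good {l@(node _ _ _)} {m} {nil} (node hl hr l< r<) _ only
    with only (node nil m l) (node hr hl r< l<)
           (↭-sym (↭-trans (shift m (inorder l) []) (prep m (↭-reflexive (++-identityʳ _))))) refl
  ... | ()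
  OnlyPreimage⇒Good {l@(node _ x _)} {m} {r@(node _ _ _)} h@(node hl hr l< r<) u only =
    node gl gr first<root (All.lookup l< (root∈ gl)) (All.lookup r< (root∈ gr))
    where
    node-injective : ∀ {l m r l′ m′ r′} → node l m r ≡ node l′ m′ r′ → l ≡ l′ × r ≡ r′
    node-injective refl = refl , refl
    onlyˡ : OnlyPreimage l
    onlyˡ l′ h′ i p = proj₁ (node-injective (only (node l′ m r)
      (node h′ hr (All-resp-↭ (↭-sym i) l<) r<) (↭-++⁺ʳ _ i) (cong (_++ postorder r ++ [ m ]) p)))
    onlyʳ : OnlyPreimage r
    onlyʳ r′ h′ i p = proj₂ (node-injective (only (node l m r′)
      (node hl h′ l< (All-resp-↭ (↭-sym i) r<)) (↭-++⁺ˡ (inorder l) (prep m i))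
      (cong (λ w → postorder l ++ w ++ [ m ]) p)))
    gl : Good l
    gl = OnlyPreimage⇒Good hl (Unique-++ˡ (inorder l) u) onlyˡ
      where
      Unique-++ˡ : ∀ v {w} → Unique (v ++ w) → Unique v
      Unique-++ˡ []      _       = []
      Unique-++ˡ (_ ∷ v) (p ∷ u) = All-++⁻ˡ v p ∷ Unique-++ˡ v u
    gr : Good r
    gr = OnlyPreimage⇒Good hr (Unique-++ʳ (inorder l) u) onlyʳ
      where
      Unique-++ʳ : ∀ v {x w} → Unique (v ++ x ∷ w) → Unique w
      Unique-++ʳ []      (_ ∷ u) = u
      Unique-++ʳ (_ ∷ v) (_ ∷ u) = Unique-++ʳ v u
    root≢first : root l ≢ first r
    root≢first e = Unique-disjoint (inorder l) u (root∈ gl) (there (subst (_∈ inorder r) (sym e) (first∈ gr)))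
    first<root : first r < root l
    first<root with <-cmp (first r) (root l)
    ... | tri< f< _ _ = f<
    ... | tri≈ _ e _  = ⊥-elim (root≢first (sym e))
    ... | tri> _ _ f> with graft hl gr (All.map (λ p → ≤-<-trans p f>) (Heap-≤root hl))
    ...   | t , ht , i , p with only (node t m nil)
              (node ht nil (All-resp-↭ (↭-sym i) (All-++⁺ l< r<)) [])
              (↭-trans (↭-++⁺ʳ [ m ] i) (↭-trans (↭-reflexive (++-assoc (inorder l) _ _))
                (↭-++⁺ˡ (inorder l) (↭-trans (shift m (inorder r) []) (prep m (↭-reflexive (++-identityʳ _)))))))
              (trans (cong (_++ [ m ]) p) (++-assoc (postorder l) _ _))
    ...     | ()

  -- Goodness of a decreasing tree can be read off the length and the descents of its sorted word,
  -- so every competitor is good too and `postorder-injective` decides.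
  Good-OnlyPreimage : ∀ {t t′} → Good t → Heap t′ → postorder t′ ≡ postorder t → t′ ≡ t
  Good-OnlyPreimage {t} {nil} g _ eq with trans eq (proj₂ (postorder-first g))
  ... | ()
  Good-OnlyPreimage {t} {node l m r} g h eq = postorder-injective
    (size⇒Good h (subst (λ w → length w ≤ 1 + 2 * descents w) (sym eq) (≤-reflexive (Good⇒size g)))) g eq

  -- Completeness of `goods` and absence of repetitions.

  -- The two sublists are fixed before `F` is given, because the recursion of `splits` changes `F`
  -- at every letter.
  ∈-splits⁺ : ∀ L {A B} → A ++ B ↭ L → ∃₂ λ X Y → (X ⊆ L × Y ⊆ L) × (A ↭ X × B ↭ Y) ×
              (∀ (F : List ℕ → List ℕ → List Tree) {t} → t ∈ F X Y → t ∈ splits F L)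
  ∈-splits⁺ [] {[]}    {[]}    _ = [] , [] , ([] , []) , (refl , refl) , λ F t∈ → t∈
  ∈-splits⁺ [] {[]}    {_ ∷ _} e with ↭-empty-inv e
  ... | ()
  ∈-splits⁺ [] {_ ∷ _}         e with ↭-empty-inv e
  ... | ()
  ∈-splits⁺ (x ∷ L) {A} {B} e with ∈-++⁻ A (∈-resp-↭ (↭-sym e) (here refl))
  ... | inj₁ x∈A with ∈-∃++ x∈A
  ...   | A₁ , A₂ , refl with ∈-splits⁺ L {A₁ ++ A₂} {B}
            (drop-∷ (↭-trans (↭-++⁺ʳ B (↭-sym (shift x A₁ A₂))) e))
  ...     | X , Y , (X⊆ , Y⊆) , (eX , eY) , f =
    x ∷ X , Y , (refl ∷ X⊆ , x ∷ʳ Y⊆) , (↭-trans (shift x A₁ A₂) (prep x eX) , eY) ,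
    λ F t∈ → ∈-++⁺ˡ (f _ t∈)
  ∈-splits⁺ (x ∷ L) {A} {B} e | inj₂ x∈B with ∈-∃++ x∈B
  ...   | B₁ , B₂ , refl with ∈-splits⁺ L {A} {B₁ ++ B₂}
            (drop-∷ (↭-trans (↭-sym (shift x A (B₁ ++ B₂))) (↭-trans (↭-++⁺ˡ A (↭-sym (shift x B₁ B₂))) e)))
  ...     | X , Y , (X⊆ , Y⊆) , (eX , eY) , f =
    X , x ∷ Y , (x ∷ʳ X⊆ , refl ∷ Y⊆) , (eX , ↭-trans (shift x B₁ B₂) (prep x eY)) ,
    λ F t∈ → ∈-++⁺ʳ (splits _ L) (f (λ a b → F a (x ∷ b)) t∈)

  goods-complete : ∀ k L {t} → length L ≤ k → Decreasing L → Good t → inorder t ↭ L → t ∈ goods k L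
  goods-complete k [] _ _ g e with ↭-empty-inv e
  goods-complete k [] _ _ (node {l} _ _ _ _ _) e | eq with ++-conicalʳ (inorder l) _ eq
  ... | ()
  goods-complete (suc k) (m ∷ L) _ _ leaf e with ↭-singleton-inv (↭-sym e)
  ... | refl = here refl
  goods-complete (suc k) (m ∷ L) (s≤s len) (m> ∷ d) g@(node {l} {m′} {r} gl gr f< ml mr) e
    with ≤-antisym
           (All.lookup (Heap-≤root (Good⇒Heap g)) (∈-resp-↭ (↭-sym e) (here refl)))
           (All.lookup (≤-refl ∷ All.map <⇒≤ m>) (∈-resp-↭ e (root∈ g)))
  ... | refl with ∈-splits⁺ L {inorder l} {inorder r} (drop-mid (inorder l) [] e)
  ...   | X , Y , (X⊆ , Y⊆) , (eX , eY) , f = ∈-++⁺ʳ (singleton m L) (f _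
    (∈-cartesianProductWith⁺ (λ l r → node l m r) l∈
      (∈-filter⁺ (λ r → first r <? top X) r∈ (subst (first r <_) (proj₂ (proj₂ (goods-sound k X dX l∈))) f<))))
    where
    dX = Decreasing-⊆ X⊆ d
    l∈ = goods-complete k X (≤-trans (length-mono-≤ X⊆) len) dX gl eX
    r∈ = goods-complete k Y (≤-trans (length-mono-≤ Y⊆) len) (Decreasing-⊆ Y⊆ d) gr eY

  -- The letters of `key t` tell which labels went left, so different splits have no element in
  -- common.
  splits-unique : ∀ (F : List ℕ → List ℕ → List T) (key : T → List ℕ) L →
    (∀ {X Y} → X ⊆ L → Y ⊆ L → X ++ Y ↭ L → Unique (F X Y)) →
    (∀ {X Y t} → X ⊆ L → Y ⊆ L → X ++ Y ↭ L → t ∈ F X Y →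
      (∀ {z} → z ∈ X → z ∈ key t) × (∀ {z} → z ∈ Y → z ∉ key t)) →
    Unique (splits F L)
  splits-unique F key []      u k = u [] [] refl
  splits-unique F key (x ∷ L) u k = Unique.++⁺
    (splits-unique _ key L (λ p q e → u (refl ∷ p) (x ∷ʳ q) (prep x e))
      (λ p q e t∈ → let ∈k , ∉k = k (refl ∷ p) (x ∷ʳ q) (prep x e) t∈ in ∈k ∘ there , ∉k))
    (splits-unique _ key L (λ p q e → u (x ∷ʳ p) (refl ∷ q) (↭-trans (shift x _ _) (prep x e)))
      (λ p q e t∈ → let ∈k , ∉k = k (x ∷ʳ p) (refl ∷ q) (↭-trans (shift x _ _) (prep x e)) t∈ in ∈k , ∉k ∘ there))
    λ { (t∈ , t∈′) → let X , Y , (p , q) , e , i = ∈-splits⁻ _ L t∈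
                         X′ , Y′ , (p′ , q′) , e′ , i′ = ∈-splits⁻ _ L t∈′
                     in proj₂ (k (x ∷ʳ p′) (refl ∷ q′) (↭-trans (shift x _ _) (prep x e′)) i′) (here refl)
                          (proj₁ (k (refl ∷ p) (x ∷ʳ q) (prep x e) i) (here refl)) }

  Unique-resp-↭ : ∀ {u w : List ℕ} → u ↭ w → Unique u → Unique w
  Unique-resp-↭ p = Unique-resp-↭ₛ (setoid ℕ) (↭⇒↭ₛ p)

  Decreasing⇒Unique : ∀ {L} → Decreasing L → Unique L
  Decreasing⇒Unique = AllPairs.map >⇒≢

  left : Tree → Tree
  left nil          = nil
  left (node l _ _) = l

  goods-unique : ∀ k L → Decreasing L → Unique (goods k L)
  goods-unique _       []              _       = []
  goods-unique zero    (_ ∷ _)         _       = []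
  goods-unique (suc k) (m ∷ [])        _       = [] ∷ []
  goods-unique (suc k) (m ∷ L@(_ ∷ _)) (_ ∷ d) = splits-unique _ (inorder ∘ left) L
    (λ {X} {Y} X⊆ Y⊆ _ → Unique.cartesianProductWith⁺ (λ l r → node l m r) (λ { refl → refl , refl })
      (goods-unique k X (Decreasing-⊆ X⊆ d))
      (Unique.filter⁺ (λ r → first r <? top X) (goods-unique k Y (Decreasing-⊆ Y⊆ d))))
    separated
    where
    separated : ∀ {X Y t} → X ⊆ L → Y ⊆ L → X ++ Y ↭ L →
      t ∈ cartesianProductWith (λ l r → node l m r) (goods k X) (filter (λ r → first r <? top X) (goods k Y)) →
      (∀ {z} → z ∈ X → z ∈ inorder (left t)) × (∀ {z} → z ∈ Y → z ∉ inorder (left t))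
    separated {X} {Y} X⊆ Y⊆ e t∈
      with ∈-cartesianProductWith⁻ (λ l r → node l m r) (goods k X) (filter (λ r → first r <? top X) (goods k Y)) t∈
    ... | l , r , l∈ , r∈ , refl with goods-sound k X (Decreasing-⊆ X⊆ d) l∈
    ...   | _ , el , _ = ∈-resp-↭ (↭-sym el) ,
      λ z∈Y z∈l → Unique-disjoint X (Unique-resp-↭ (↭-sym e) (Decreasing⇒Unique d)) (∈-resp-↭ el z∈l) z∈Y

  -- The pigeonhole principle and permutations as words.

  Unique-⊆⇒↭ : ∀ {xs ys : List T} → Unique xs → (∀ {x} → x ∈ xs → x ∈ ys) → ∃ λ zs → ys ↭ xs ++ zs
  Unique-⊆⇒↭ {ys = ys} []       _  = ys , refl
  Unique-⊆⇒↭ {xs = x ∷ xs} (x∉ ∷ u) xs⊆ with ∈-∃++ (xs⊆ (here refl))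
  ... | as , bs , refl with Unique-⊆⇒↭ u rest
    where
    rest : ∀ {y} → y ∈ xs → y ∈ as ++ bs
    rest y∈ with ∈-resp-↭ (shift x as bs) (xs⊆ (there y∈))
    ... | here refl = ⊥-elim (All.lookup x∉ y∈ refl)
    ... | there y∈′ = y∈′
  ... | zs , e = zs , ↭-trans (shift x as bs) (prep x e)

  Unique-⊆⇒length≤ : ∀ {xs ys : List T} → Unique xs → (∀ {x} → x ∈ xs → x ∈ ys) → length xs ≤ length ys
  Unique-⊆⇒length≤ {xs = xs} u xs⊆ with Unique-⊆⇒↭ u xs⊆
  ... | zs , e = subst (length xs ≤_) (sym (trans (↭-length e) (length-++ xs))) (m≤m+n _ _)

  Unique-⊆-length⇒↭ : ∀ {xs ys : List T} → Unique xs → (∀ {x} → x ∈ xs → x ∈ ys) →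
                      length xs ≡ length ys → xs ↭ ys
  Unique-⊆-length⇒↭ {xs = xs} u xs⊆ eq with Unique-⊆⇒↭ u xs⊆
  ... | [] , e = ↭-sym (↭-trans e (↭-reflexive (++-identityʳ xs)))
  ... | z ∷ zs , e = ⊥-elim (m≢1+m+n (length xs)
    (trans eq (trans (↭-length e) (trans (length-++ xs) (+-suc (length xs) (length zs))))))

  words-length : ∀ letters n {w} → w ∈ words letters n → length w ≡ n
  words-length letters zero    (here refl) = refl
  words-length letters (suc n) w∈ with ∈-cartesianProductWith⁻ _∷_ letters (words letters n) w∈
  ... | _ , _ , _ , w′∈ , refl = cong suc (words-length letters n w′∈)

  words-letters : ∀ letters n {w z} → w ∈ words letters n → z ∈ w → z ∈ letters
  words-letters letters zero    (here refl) ()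
  words-letters letters (suc n) w∈ z∈ with ∈-cartesianProductWith⁻ _∷_ letters (words letters n) w∈
  words-letters letters (suc n) w∈ (here refl) | _ , _ , x∈ , _ , refl = x∈
  words-letters letters (suc n) w∈ (there z∈)  | _ , _ , _ , w′∈ , refl = words-letters letters n w′∈ z∈

  ∈-words : ∀ letters w → (∀ {z} → z ∈ w → z ∈ letters) → w ∈ words letters (length w)
  ∈-words letters []      _ = here refl
  ∈-words letters (x ∷ w) p = ∈-cartesianProductWith⁺ _∷_ (p (here refl)) (∈-words letters w (p ∘ there))

  words-unique : ∀ {letters} n → Unique letters → Unique (words letters n)
  words-unique zero    u = [] ∷ []
  words-unique (suc n) u = Unique.cartesianProductWith⁺ _∷_ ∷-injective u (words-unique n u)

  labels : ℕ → List ℕ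
  labels = applyDownFrom suc

  labels-decreasing : ∀ n → Decreasing (labels n)
  labels-decreasing n = AllPairs.applyDownFrom⁺₁ suc n λ j<i _ → s≤s j<i

  letters↭labels : ∀ n → applyUpTo suc n ↭ labels n
  letters↭labels n = ↭-trans (↭-sym (↭-reverse _)) (↭-reflexive (reverse-applyUpTo suc n))

  letters-unique : ∀ n → Unique (applyUpTo suc n)
  letters-unique n = Unique-resp-↭ (↭-sym (letters↭labels n)) (Decreasing⇒Unique (labels-decreasing n))

  S-unique : ∀ n → Unique (S n)
  S-unique n = Unique.filter⁺ (unique? _≟_) (words-unique n (letters-unique n))

  ∈S⁻ : ∀ n {w} → w ∈ S n → w ↭ labels n
  ∈S⁻ n {w} w∈ with ∈-filter⁻ (unique? _≟_) {xs = words (applyUpTo suc n) n} w∈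
  ... | w∈′ , u = ↭-trans (Unique-⊆-length⇒↭ u (words-letters _ n w∈′)
                    (trans (words-length _ n w∈′) (sym (length-applyUpTo suc n)))) (letters↭labels n)

  ∈S⁺ : ∀ n {w} → w ↭ labels n → w ∈ S n
  ∈S⁺ n {w} e = ∈-filter⁺ (unique? _≟_)
    (subst (λ k → w ∈ words (applyUpTo suc n) k) (trans (↭-length e) (length-applyDownFrom suc n))
      (∈-words _ w (∈-resp-↭ (↭-trans e (↭-sym (letters↭labels n))))))
    (Unique-resp-↭ (↭-sym e) (Decreasing⇒Unique (labels-decreasing n)))

  ∈-preimages⁺ : ∀ n {σ π} → σ ∈ S n → s σ ≡ π → σ ∈ preimages n π
  ∈-preimages⁺ n {π = π} = ∈-filter⁺ (λ σ → ≡-dec _≟_ (s σ) π)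

  ∈-preimages⁻ : ∀ n {σ π} → σ ∈ preimages n π → σ ∈ S n × s σ ≡ π
  ∈-preimages⁻ n {π = π} = ∈-filter⁻ (λ σ → ≡-dec _≟_ (s σ) π) {xs = S n}

  Unique-single : ∀ {x : T} {xs} → Unique xs → x ∈ xs → (∀ {y} → y ∈ xs → y ≡ x) → length xs ≡ 1
  Unique-single ([] ∷ [])              _ _  = refl
  Unique-single ((x≢y ∷ _) ∷ _ ∷ _) _ eq = ⊥-elim (x≢y (trans (eq (here refl)) (sym (eq (there (here refl))))))

  -- The root is the largest label. If the cut points differed, it would also occur in a left
  -- subtree, whose labels are all smaller.
  inorder-injective : ∀ {t t′} → Heap t → Heap t′ → inorder t ≡ inorder t′ → t ≡ t′
  inorder-injective nil nil _ = refl
  inorder-injective nil (node {l} _ _ _ _) eq with ++-conicalʳ (inorder l) _ (sym eq)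
  ... | ()
  inorder-injective (node {l} _ _ _ _) nil eq with ++-conicalʳ (inorder l) _ eq
  ... | ()
  inorder-injective h@(node {l} {m} {r} hl hr l< _) h′@(node {l′} {m′} {r′} hl′ hr′ l′< _) eq
    with ≤-antisym
           (All.lookup (Heap-≤root h′) (subst (m ∈_) eq (∈-++⁺ʳ (inorder l) (here refl))))
           (All.lookup (Heap-≤root h) (subst (m′ ∈_) (sym eq) (∈-++⁺ʳ (inorder l′) (here refl))))
  ... | refl with ++-compare (inorder l) (inorder l′) eq
  ...   | inj₁ ([] , el , er) = cong₂ (λ l r → node l m r)
    (inorder-injective hl hl′ (trans (sym (++-identityʳ _)) (sym el)))
    (inorder-injective hr hr′ (proj₂ (∷-injective er)))
  ...   | inj₁ (_ ∷ _ , el , er) with proj₁ (∷-injective er)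
  ...     | refl = ⊥-elim (<-irrefl refl (All.lookup (subst (All (_< m)) el l′<) (∈-++⁺ʳ (inorder l) (here refl))))
  inorder-injective (node {m = m} _ _ l< _) (node {l = l′} _ _ _ _) _ | refl | inj₂ (_ , _ , el , er)
    with proj₁ (∷-injective er)
  ... | refl = ⊥-elim (<-irrefl refl (All.lookup (subst (All (_< m)) el l<) (∈-++⁺ʳ (inorder l′) (here refl))))

  -- Uniquely sorted permutations correspond to good trees.

  Good⇒UniquelySorted : ∀ n {t} → Good t → inorder t ↭ labels n → UniquelySorted n (postorder t)
  Good⇒UniquelySorted n {t} g e = Unique-single
    (Unique.filter⁺ (λ σ → ≡-dec _≟_ (s σ) (postorder t)) (S-unique n))
    (∈-preimages⁺ n (∈S⁺ n e) (s-inorder (Good⇒Heap g)))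
    λ σ∈ → let σ∈S , sσ = ∈-preimages⁻ n σ∈
               t′ , h′ , eq = heap-of (Unique-resp-↭ (↭-sym (∈S⁻ n σ∈S)) (Decreasing⇒Unique (labels-decreasing n)))
           in trans (sym eq) (cong inorder
                (Good-OnlyPreimage g h′ (trans (sym (s-inorder h′)) (trans (cong s eq) sσ))))

  -- The length has to be positive: the empty permutation is uniquely sorted, but the empty tree is
  -- not good.
  UniquelySorted⇒Good : ∀ n {π} → UniquelySorted (suc n) π →
                        ∃ λ t → Good t × inorder t ↭ labels (suc n) × postorder t ≡ π
  UniquelySorted⇒Good n {π} us with preimages (suc n) π in eq
  ... | σ ∷ [] with ∈-preimages⁻ (suc n) {σ} {π} (subst (σ ∈_) (sym eq) (here refl))
  ...   | σ∈ , refl with ∈S⁻ (suc n) σ∈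
  ...     | σ↭ with heap-of (Unique-resp-↭ (↭-sym σ↭) (Decreasing⇒Unique (labels-decreasing (suc n))))
  ...       | nil , _ , refl with ↭-empty-inv (↭-sym σ↭)
  ...         | ()
  UniquelySorted⇒Good n {π} us | σ ∷ [] | σ∈ , refl | σ↭ | t@(node _ _ _) , h , refl =
    t , OnlyPreimage⇒Good h (Unique-resp-↭ (↭-sym σ↭) (Decreasing⇒Unique (labels-decreasing (suc n)))) only ,
    σ↭ , sym (s-inorder h)
    where
    only : OnlyPreimage t
    only t′ h′ e p with subst (inorder t′ ∈_) eq (∈-preimages⁺ (suc n) (∈S⁺ (suc n) (↭-trans e σ↭))
                          (trans (s-inorder h′) (trans p (sym (s-inorder h)))))
    ... | here e′ = inorder-injective h′ h e′

  -- `postorder` is injective on good trees and makes the leftmost leaf the first entry. Both lists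
  -- are free of repetitions, so mutual inclusion gives equal lengths.
  A-as-trees : ∀ k ℓ → let n = suc (2 * k) in
               A k ℓ ≡ length (filter (λ t → first t ≟ ℓ) (goods n (labels n)))
  A-as-trees k ℓ rewrite +-comm (2 * k) 1 = trans
    (≤-antisym (Unique-⊆⇒length≤ (Unique.filter⁺ P? (S-unique n)) to)
               (Unique-⊆⇒length≤ (unique-postorders (Unique.filter⁺ first? (goods-unique n _ (labels-decreasing n))) members) from))
    (length-map postorder trees)
    where
    n = suc (2 * k)
    P? = λ π → uniquelySorted? n π ×-dec startsWith? ℓ π
    first? = λ t → first t ≟ ℓ
    trees = filter first? (goods n (labels n))

    members : ∀ {t} → t ∈ trees → Good t × inorder t ↭ labels n
    members t∈ =
      let good , e , _ = goods-sound n (labels n) (labels-decreasing n) (proj₁ (∈-filter⁻ first? {xs = goods n (labels n)} t∈))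
      in good , e

    unique-postorders : ∀ {ts} → Unique ts → (∀ {t} → t ∈ ts → Good t × inorder t ↭ labels n) → Unique (map postorder ts)
    unique-postorders []       _ = []
    unique-postorders {t ∷ ts} (t∉ ∷ u) g = All.tabulate distinct ∷ unique-postorders u (g ∘ there)
      where
      distinct : ∀ {w} → w ∈ map postorder ts → postorder t ≢ w
      distinct w∈ with ∈-map⁻ postorder w∈
      ... | t′ , t′∈ , refl = λ eq → All.lookup t∉ t′∈
        (postorder-injective (proj₁ (g (here refl))) (proj₁ (g (there t′∈))) eq)

    head-postorder : ∀ {t} → Good t → head (postorder t) ≡ just (first t)
    head-postorder g = cong head (proj₂ (postorder-first g))

    to : ∀ {π} → π ∈ filter P? (S n) → π ∈ map postorder trees
    to π∈ with ∈-filter⁻ P? {xs = S n} π∈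
    ... | _ , us , st with UniquelySorted⇒Good (2 * k) us
    ...   | t , g , e , refl = ∈-map⁺ postorder (∈-filter⁺ first?
      (goods-complete n (labels n) (≤-reflexive (length-applyDownFrom suc n)) (labels-decreasing n) g e)
      (just-injective (trans (sym (head-postorder g)) st)))

    from : ∀ {π} → π ∈ map postorder trees → π ∈ filter P? (S n)
    from π∈ with ∈-map⁻ postorder π∈
    ... | t , t∈ , refl with members t∈
    ...   | g , e = ∈-filter⁺ P? (∈S⁺ n (↭-trans (postorder↭inorder t) e))
      (Good⇒UniquelySorted n g e ,
       trans (head-postorder g) (cong just (proj₂ (∈-filter⁻ first? {xs = goods n (labels n)} t∈))))

-- The reflection of the first entry.

open import Data.Nat.Base using (_+_; _*_; _∸_)
open import Data.Nat.Properties using (+-comm; +-∸-assoc; m∸n+n≡m)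
open Series using (γ; γ-sym; tag; Two; above; below; 0ℤ; 1ℤ; ofℕ; ofℕ-0; ofℕ-suc; ofℕ-injective; +-identityˡ)
open Enumeration using (first; goods; ∑; ⟦_⟧; count; count-tag)
open StackSorting using (labels; labels-decreasing; A-as-trees)

count-as-length : ∀ k L a → ofℕ (length (filter (λ t → first t ≟ a) (goods k L))) ≡ count k L a
count-as-length k L a = go (goods k L)
  where
  go : ∀ ts → ofℕ (length (filter (λ t → first t ≟ a) ts)) ≡ ∑ (λ t → ⟦ does (first t ≟ a) ⟧) ts
  go []       = ofℕ-0
  go (t ∷ ts) with does (first t ≟ a)
  ... | true  = trans (ofℕ-suc _) (cong (1ℤ Series.+_) (go ts))
  ... | false = trans (go ts) (sym (+-identityˡ _))

labels-split : ∀ p q → ∃₂ λ U V → labels (suc (p + q)) ≡ U ++ suc q ∷ V × length U ≡ p × length V ≡ q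
labels-split zero    q = [] , labels q , refl , refl , length-applyDownFrom suc q
labels-split (suc p) q with labels-split p q
... | U , V , eq , refl , refl = let top = suc (suc (length U + length V)) in
  top ∷ U , V , cong (top ∷_) eq , refl , refl

tag-cong : ∀ {U V U′ V′ : List ℕ} → length U ≡ length U′ → length V ≡ length V′ → tag U V ≡ tag U′ V′
tag-cong {U} {V} {U′} {V′} p q = cong₂ _++_ (same U U′ above p) (same V V′ below q)
  where
  same : ∀ (X Y : List ℕ) (z : Two) → length X ≡ length Y → map (const z) X ≡ map (const z) Y
  same []      []      z _  = refl
  same (_ ∷ X) (_ ∷ Y) z eq = cong (z ∷_) (same X Y z (suc-injective eq))

-- With first entry ℓ = `suc q`, there are `p` labels above and `q` labels below it. The reflection
-- of ℓ to 2k + 2 - ℓ exchanges `p` and `q`.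
A-as-γ : ∀ k p q → p + q ≡ 2 * k → ∃₂ λ U V → length U ≡ p × length V ≡ q × ofℕ (A k (suc q)) ≡ γ (tag U V)
A-as-γ k p q eq with labels-split p q
... | U , V , split , lenU , lenV = U , V , lenU , lenV , (begin
  ofℕ (A k (suc q))
    ≡⟨ cong ofℕ (A-as-trees k (suc q)) ⟩
  ofℕ (length (filter (λ t → first t ≟ suc q) (goods n (labels n))))
    ≡⟨ count-as-length n (labels n) (suc q) ⟩
  count n (labels n) (suc q)
    ≡⟨ cong (λ L → count n L (suc q)) labels-n ⟩
  count n (U ++ suc q ∷ V) (suc q)
    ≡⟨ count-tag n U (suc q) V
         (≤-reflexive (trans (cong length (sym labels-n)) (length-applyDownFrom suc n)))
         (subst (AllPairs _>_) labels-n (labels-decreasing n)) ⟩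
  γ (tag U V) ∎)
  where
  open ≡-Reasoning
  n = suc (2 * k)
  labels-n : labels n ≡ U ++ suc q ∷ V
  labels-n = trans (cong (labels ∘ suc) (sym eq)) split

theorem5p7 : ∀ (k ℓ : ℕ) → 1 ≤ ℓ → ℓ ≤ 2 * k + 1 →
    A k ℓ ≡ A k (2 * k + 2 ∸ ℓ)
theorem5p7 k (suc q) _ ℓ≤ with ≤-pred (subst (suc q ≤_) (+-comm (2 * k) 1) ℓ≤)
... | q≤2k with 2 * k ∸ q in eq | m∸n+n≡m q≤2k
... | p | p+q with A-as-γ k p q p+q | A-as-γ k q p (trans (+-comm q p) p+q)
... | U , V , refl , refl , left | U′ , V′ , lenU′ , lenV′ , right = ofℕ-injective (begin
  ofℕ (A k (suc (length V)))   ≡⟨ left ⟩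
  γ (tag U V)                  ≡⟨ γ-sym U V ⟩
  γ (tag V U)                  ≡⟨ cong γ (tag-cong {V} {U} {U′} {V′} (sym lenU′) (sym lenV′)) ⟩
  γ (tag U′ V′)                ≡⟨ right ⟨
  ofℕ (A k (suc (length U)))   ≡⟨ cong (ofℕ ∘ A k) reflected ⟩
  ofℕ (A k (2 * k + 2 ∸ suc (length V))) ∎)
  where
  open ≡-Reasoning
  reflected : suc (length U) ≡ 2 * k + 2 ∸ suc (length V)
  reflected = sym (trans (cong (_∸ suc (length V)) (+-comm (2 * k) 2))
    (trans (+-∸-assoc 1 q≤2k) (cong suc eq)))
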